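{- Let $h>1$ be an integer, $q=2^h$, and let $U$ be a nonempty subset of $\mathrm{GF}(q)^{\star}$ with $|U|<\frac{q}{4}-1$. Then no regular hyperoval $\Omega$ of $AG(2,q^2)$ is an inherited hyperoval of $\mathcal M_U(q^2)$; that is, for every regular hyperoval $\Omega$ of $AG(2,q^2)$, the point set $\Omega$ is not an arc of the projective closure $\overline{\mathcal M_U(q^2)}$ (some line of $\overline{\mathcal M_U(q^2)}$ contains at least three points of $\Omega$).
   Context: For a prime power $q$, the norm is $\|x\|=x^{q+1}$ for $x\in\mathrm{GF}(q^2)$. For a proper subset $U$ of $\mathrm{GF}(q)^{\star}$, define on $\mathrm{GF}(q^2)$ the product $a\odot b=ab$ if $\|b\|\notin U$ and $a\odot b=a^q b$ if $\|b\|\in U$. The affine plane $\mathcal M_U(q^2)$ has as points the points $P(x,y)$ of $AG(2,q^2)$, and as lines the sets $[c]=\{P(x,y): x=c\}$ and $[m,n]=\{P(x,y): y=m\odot x+n\}$ for $c,m,n\in\mathrm{GF}(q^2)$. Its projective closure $\overline{\mathcal M_U(q^2)}$ is obtained by adding one point at infinity per parallel class (lines $[m,n]$ with fixed $m$; the lines $[c]$) and the line at infinity. For $q$ even, a regular hyperoval of $PG(2,q^2)$ is the union of a non-degenerate conic and its nucleus; a regular hyperoval of $AG(2,q^2)$ is one all of whose $q^2+2$ points are affine. An arc is a set of points no three of which are collinear. -}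

module Defs where

open import Algebra.Apartness.Bundles using (HeytingField; HeytingCommutativeRing)
import Algebra.Apartness.Properties.HeytingCommutativeRing as HCR
import Algebra.Properties.Semiring.Exp as Exp
open import Algebra.Bundles using (CommutativeRing)
open import Data.Bool.Base using (if_then_else_)
open import Data.Empty.Polymorphic using () renaming (⊥ to ⊥ₚ)
open import Data.Fin.Base using (Fin)
open import Data.Maybe.Base using (just; nothing)
import Data.Maybe.Relation.Binary.Pointwise as Maybe
open import Data.Nat.Base using (ℕ; suc)
open import Data.Product.Base using (Σ; ∃-syntax; _×_; _,_; proj₁; proj₂)
open import Data.Product.Relation.Binary.Pointwise.NonDependent using (_×ₛ_)
open import Data.Sum.Base using (_⊎_; inj₁; inj₂)
open import Data.Sum.Relation.Binary.Pointwise using (_⊎ₛ_)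
open import Data.Unit.Polymorphic using () renaming (⊤ to ⊤ₚ)
open import Function.Bundles using (Inverse; _⇔_)
open import Level using (Level; _⊔_)
open import Relation.Binary.Bundles using (Setoid)
import Relation.Binary.Construct.On as On
open import Relation.Binary.Definitions using (_Respects_)
import Relation.Binary.PropositionalEquality as ≡
open import Relation.Nullary using (¬_; does)
open import Relation.Unary using (Pred; Decidable; _∈_)

private
  variable
    a ℓ p : Level

HasSize : Setoid a ℓ → ℕ → Set (a ⊔ ℓ)
HasSize S n = Inverse S (≡.setoid (Fin n))

module Subsets (S : Setoid a ℓ) where
  open Setoid S

  ∣_∣≡_ : Pred Carrier p → ℕ → Set (a ⊔ ℓ ⊔ p)
  ∣ P ∣≡ n = HasSize (On.setoid S (proj₁ {B = P})) n

-- A Heyting field with finitely many elements is a finite field in the usual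
-- sense: equality and invertibility are then decidable, so x # y is equivalent
-- to ¬ x ≈ y.
module FieldTheory {c ℓ₁ ℓ₂} (K : HeytingField c ℓ₁ ℓ₂) where

  open HeytingField K public
    using (Carrier; _≈_; _+_; _*_; _-_; -_; 0#; 1#; #-irrefl; heytingCommutativeRing)
  open CommutativeRing (HeytingCommutativeRing.commutativeRing heytingCommutativeRing) public
    using (setoid; semiring)
  open Exp semiring public using (_^_)

  HasOrder : ℕ → Set (c ⊔ ℓ₁)
  HasOrder n = HasSize setoid n

  record IsSubfield (F : Pred Carrier p) : Set (c ⊔ ℓ₁ ⊔ p) where
    field
      resp       : F Respects _≈_
      0-closed   : 0# ∈ F
      1-closed   : 1# ∈ F
      +-closed   : ∀ {x y} → x ∈ F → y ∈ F → x + y ∈ F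
      neg-closed : ∀ {x} → x ∈ F → - x ∈ F
      *-closed   : ∀ {x y} → x ∈ F → y ∈ F → x * y ∈ F
      inv-closed : ∀ {x y} → x ∈ F → x * y ≈ 1# → y ∈ F

  infix 8 _⋆
  _⋆ : Pred Carrier p → Pred Carrier (ℓ₁ ⊔ p)
  (F ⋆) x = x ∈ F × ¬ x ≈ 0#

  AffinePoint : Set c
  AffinePoint = Carrier × Carrier

module ProjectivePlane {c ℓ₁ ℓ₂} (K : HeytingField c ℓ₁ ℓ₂) where

  open FieldTheory K

  K³ : Set c
  K³ = Carrier × Carrier × Carrier

  _+ᵥ_ : K³ → K³ → K³
  (x , y , z) +ᵥ (x′ , y′ , z′) = (x + x′) , (y + y′) , (z + z′)

  NonZero : Pred K³ ℓ₁
  NonZero (x , y , z) = ¬ (x ≈ 0# × y ≈ 0# × z ≈ 0#)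

  -- Points and lines are both nonzero triples up to proportionality; the line
  -- (a , b , c) is a X + b Y + c Z = 0.
  PGPoint PGLine : Set (c ⊔ ℓ₁)
  PGPoint = Σ K³ NonZero
  PGLine  = Σ K³ NonZero

  -- The scalar t is automatically nonzero since the left-hand triple is.
  _∼_ : PGPoint → PGPoint → Set (c ⊔ ℓ₁)
  ((x , y , z) , _) ∼ ((x′ , y′ , z′) , _) =
    ∃[ t ] (x ≈ t * x′ × y ≈ t * y′ × z ≈ t * z′)

  _onPG_ : PGPoint → PGLine → Set ℓ₁
  ((x , y , z) , _) onPG ((a , b , c) , _) = (a * x + b * y) + c * z ≈ 0#

  -- AG(2,K) is the complement of the line Z = 0.
  IsAffine : Pred PGPoint ℓ₁
  IsAffine ((x , y , z) , _) = ¬ z ≈ 0#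

  embed : AffinePoint → PGPoint
  embed (x , y) = (x , y , 1#) , λ (_ , _ , 1≈0) → #-irrefl 1≈0 (HCR.1#0 heytingCommutativeRing)

  record QuadraticForm : Set c where
    field
      xx yy zz xy xz yz : Carrier

  eval : QuadraticForm → K³ → Carrier
  eval Q (x , y , z) =
    ((((xx * (x * x) + yy * (y * y)) + zz * (z * z)) + xy * (x * y)) + xz * (x * z)) + yz * (y * z)
    where open QuadraticForm Q

  polar : QuadraticForm → K³ → K³ → Carrier
  polar Q v w = (eval Q (v +ᵥ w) - eval Q v) - eval Q w

  -- No nonzero singular vector lies in the radical of the polar form.
  -- Nondegeneracy of the polar form itself would be the wrong condition: in
  -- characteristic 2 it is alternating on a space of odd dimension.
  NonDegenerate : QuadraticForm → Set (c ⊔ ℓ₁)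
  NonDegenerate Q =
    ∀ v → NonZero v → ¬ (eval Q v ≈ 0# × (∀ w → polar Q v w ≈ 0#))

  Conic : QuadraticForm → Pred PGPoint ℓ₁
  Conic Q (v , _) = eval Q v ≈ 0#

  IsTangent : Pred PGPoint p → PGLine → Set (c ⊔ ℓ₁ ⊔ p)
  IsTangent S L =
    ∃[ P ] (P ∈ S × P onPG L × (∀ R → R ∈ S → R onPG L → R ∼ P))

  -- For |K| even and a non-degenerate conic there is exactly one such point.
  IsNucleus : Pred PGPoint p → PGPoint → Set (c ⊔ ℓ₁ ⊔ p)
  IsNucleus S N = ∀ L → IsTangent S L → N onPG L

  ConicWithNucleus : QuadraticForm → PGPoint → Pred PGPoint (c ⊔ ℓ₁)
  ConicWithNucleus Q N P = P ∈ Conic Q ⊎ P ∼ N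

  record IsRegularAffineHyperoval (Ω : Pred AffinePoint p) : Set (c ⊔ ℓ₁ ⊔ p) where
    field
      form            : QuadraticForm
      nucleus         : PGPoint
      nondegenerate   : NonDegenerate form
      isNucleus       : IsNucleus (Conic form) nucleus
      allPointsAffine : ∀ P → P ∈ ConicWithNucleus form nucleus → IsAffine P
      points          : ∀ A → A ∈ Ω ⇔ embed A ∈ ConicWithNucleus form nucleus

-- The projective closure of the plane M_U(q²), for K of order q².
module MoultonPlane {c ℓ₁ ℓ₂ u} (K : HeytingField c ℓ₁ ℓ₂) (q : ℕ)
  (U : Pred (HeytingField.Carrier K) u) (U? : Decidable U) where

  open FieldTheory K

  ∥_∥ : Carrier → Carrier
  ∥ x ∥ = x ^ suc q

  infixl 7 _⊙_
  _⊙_ : Carrier → Carrier → Carrier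
  a ⊙ b = if does (U? ∥ b ∥) then (a ^ q) * b else a * b

  pointSetoid : Setoid c (c ⊔ ℓ₁)
  pointSetoid = (setoid ×ₛ setoid) ⊎ₛ Maybe.setoid setoid

  open Setoid pointSetoid public using () renaming (Carrier to Point; _≈_ to _≈ₚ_)

  pattern affine x y = inj₁ (x , y)
  -- The common point at infinity of the lines [m,n] = line m n, n ∈ K.
  pattern slope m = inj₂ (just m)
  -- The common point at infinity of the lines [c] = vline c.
  pattern vertical = inj₂ nothing

  data Line : Set c where
    vline : Carrier → Line
    line  : Carrier → Carrier → Line
    ℓ∞    : Line

  infix 4 _on_
  _on_ : Point → Line → Set ℓ₁
  affine x y on vline k   = x ≈ k
  affine x y on line m n  = y ≈ m ⊙ x + n
  affine x y on ℓ∞        = ⊥ₚ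
  slope m    on vline k   = ⊥ₚ
  slope m    on line m′ n = m ≈ m′
  slope m    on ℓ∞        = ⊤ₚ
  vertical   on vline k   = ⊤ₚ
  vertical   on line m n  = ⊥ₚ
  vertical   on ℓ∞        = ⊤ₚ

  ContainsThreeOf : Pred Point p → Pred Line (c ⊔ ℓ₁ ⊔ p)
  ContainsThreeOf S L =
    ∃[ P ] ∃[ Q ] ∃[ R ]
      (P ∈ S × Q ∈ S × R ∈ S) ×
      (¬ P ≈ₚ Q × ¬ P ≈ₚ R × ¬ Q ≈ₚ R) ×
      (P on L × Q on L × R on L)

  IsArc : Pred Point p → Set (c ⊔ ℓ₁ ⊔ p)
  IsArc S = ¬ (∃[ L ] ContainsThreeOf S L)

  asPoints : Pred AffinePoint p → Pred Point p
  asPoints Ω (inj₁ A) = A ∈ Ω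
  asPoints Ω (inj₂ _) = ⊥ₚ

  -- Meant for hyperovals Ω of AG(2,q²).
  IsInherited : Pred AffinePoint p → Set (c ⊔ ℓ₁ ⊔ p)
  IsInherited Ω = IsArc (asPoints Ω)

{-# OPTIONS --safe #-}

-- Suppose that no line contains three points of the hyperoval Ω. By the norm of a point mean that of
-- its abscissa, and let P ∈ Ω be a point whose norm ν lies in U. For every m the affine line of slope
-- m through P meets Ω in a second point Q. If the norm of Q is outside U, then the Moulton line of
-- slope m through Q, being incident with another point of Ω like every line through Q, contains some
-- R ∈ Ω with norm in U. There are at most 2 |U| (q + 1) points of Ω with norm in U; such a point is Q
-- for at most one m, and it is R for at most one m if its norm differs from ν and for at most q values
-- of m otherwise. Hence q² ≤ 4 |U| (q + 1) + e q, where e is the number of R of norm ν. Combining the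
-- equation of the conic with its conjugate shows that the abscissae of these R are zeros of a quartic,
-- so that e ≤ 7 unless the quartic vanishes identically, and 4 |U| ≤ q - 8 gives a contradiction.
--
-- It remains to find P, for a given ν ∈ U, such that the quartic does not vanish. Let x₀ be the
-- abscissa of the nucleus. If ν ≠ ‖x₀‖, every point of norm ν will do; were there none, a trace
-- polynomial of degree q would have the q + 1 elements of norm ν among its zeros. If ν = ‖x₀‖, one of
-- three explicit points will do.

module Submission where

open import Defs
open import Algebra.Apartness.Bundles using (HeytingField; HeytingCommutativeRing)
import Algebra.Apartness.Properties.HeytingCommutativeRing as HCR
open import Algebra.Bundles using (CommutativeRing; RawRing)
open import Algebra.Core using (Op₁; Op₂)
import Algebra.Morphism.RingMonomorphism as RingMonomorphism
open import Algebra.Morphism.Structures using (IsRingMonomorphism)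
import Algebra.Properties.CommutativeMonoid.Sum as Sum
import Algebra.Properties.Monoid.Mult as Mult
import Algebra.Properties.Ring as RingProperties
import Algebra.Properties.Semiring.Exp as Exp
import Algebra.Solver.Ring as RingSolver
open import Algebra.Solver.Ring.AlmostCommutativeRing using (_-Raw-AlmostCommutative⟶_; fromCommutativeRing)
open import Algebra.Structures using (IsCommutativeRing)
open import Data.Bool.Base using (Bool; true; false; _xor_; _∧_; if_then_else_)
import Data.Bool.Properties as Bool
open import Data.Empty using (⊥; ⊥-elim)
open import Data.Fin.Base as Fin using (Fin; punchIn)
open import Data.Fin.Permutation using (Permutation′; _⟨$⟩ʳ_; permutation)
import Data.Fin.Properties as Fin
open import Data.List.Base using (List; []; _∷_; length; map; filter; cartesianProduct; allFin)
open import Data.List.Membership.Propositional using (_∈_)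
import Data.List.Membership.Propositional.Properties as ∈
open import Data.List.Properties using (length-map; length-tabulate; length-++)
open import Data.List.Relation.Binary.Sublist.Propositional using ([]; _∷_; _∷ʳ_) renaming (_⊆_ to _⊑_)
open import Data.List.Relation.Binary.Sublist.Propositional.Properties using (All-resp-⊆)
open import Data.List.Relation.Unary.All as All using (All; []; _∷_)
import Data.List.Relation.Unary.All.Properties as All
open import Data.List.Relation.Unary.AllPairs using ([]; _∷_)
open import Data.List.Relation.Unary.Any as Any using (Any; here; there)
import Data.List.Relation.Unary.Any.Properties as Any
open import Data.List.Relation.Unary.Unique.Propositional using (Unique)
import Data.List.Relation.Unary.Unique.Propositional.Properties as Unique
import Data.Maybe.Base as Maybe
open import Data.Nat.Base as ℕ using (ℕ; zero; suc; _≤_; z≤n; s≤s)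
import Data.Nat.Properties as ℕ
open import Data.Nat.Solver using (module +-*-Solver)
open import Data.Product.Base using (∃-syntax; _×_; _,_; proj₁; proj₂)
open import Data.Product.Properties using (≡-dec)
open import Data.Sum.Base using (_⊎_; inj₁; inj₂)
open import Data.Sum.Relation.Binary.Pointwise as Pointwise using ()
open import Data.Unit.Base using (⊤)
open import Function.Base using (_∘_; id; case_of_)
open import Function.Bundles using (Inverse; module Equivalence)
open import Level using (Level)
open import Relation.Binary.Definitions using (DecidableEquality; _Respects_)
open import Relation.Binary.PropositionalEquality hiding (setoid)
open import Relation.Nullary using (¬_; Dec; yes; no; contradiction; does)
open import Relation.Nullary.Decidable using (map′; dec⇒maybe; _×-dec_; ¬?; _⊎-dec_; dec-true; dec-false)
open import Relation.Unary using (Pred; Decidable; Satisfiable)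

-- A point of norm ν, P itself among them, can be R for up to q slopes, so very few such points are
-- affordable. As (q - 8)(q + 1) + 7 q = q² - 8, the value e = 7 just fits the hypothesis on |U|,
-- while e = 8 would not. The 7 consists of four zeros of the quartic that determine their points,
-- two points above the zero of a linear polynomial `D`, and the nucleus. Since Ω has no point at
-- infinity, the quadratic form of the conic is anisotropic. The leading coefficient of the quartic
-- is a value of this form, at a pair (γ, α), so that only γ = α = 0 has to be avoided by the choice
-- of P.
--
-- The trace polynomial can have degree q, one less than the size of a norm circle, because
-- conjugation acts on the circle as a fractional linear map: an absolute trace of the field of
-- order q² becomes a trace from the field of order q of a quotient of polynomials of degrees 2 and
-- 1.
--
-- The counting only refutes the absence of collinear triples; the line demanded by the conclusion
-- comes from an exhaustive search.

module Counting where

  -- Cardinality bounds and double counting.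

  private
    variable
      a b ℓ p r t : Level
      A : Set a
      B : Set b
      k l n : ℕ
      P : A → Set p
      Q : A → Set r
      R : A → Set t

  Unique-resp-⊒ : {xs ys : List A} → ys ⊑ xs → Unique xs → Unique ys
  Unique-resp-⊒ []          []       = []
  Unique-resp-⊒ (_ ∷ʳ s)    (_ ∷ us) = Unique-resp-⊒ s us
  Unique-resp-⊒ (refl ∷ s)  (u ∷ us) = All-resp-⊆ s u ∷ Unique-resp-⊒ s us

  -- Testing duplicate-free lists requires neither an enumeration nor a decision procedure for `P`.
  AtMost : ℕ → (A → Set ℓ) → Set _
  AtMost k P = ∀ {xs} → Unique xs → All P xs → length xs ≤ k

  atMost-⊆ : (∀ {x} → Q x → P x) → AtMost k P → AtMost k Q
  atMost-⊆ Q⊆P p u qs = p u (All.map Q⊆P qs)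

  atMost-≤ : k ≤ l → AtMost k P → AtMost l P
  atMost-≤ k≤l p u ps = ℕ.≤-trans (p u ps) k≤l

  atMost-0 : (∀ {x} → ¬ P x) → AtMost 0 P
  atMost-0 ¬p {[]}    _ _        = z≤n
  atMost-0 ¬p {_ ∷ _} _ (px ∷ _) = contradiction px ¬p

  atMost-1 : (∀ {x y} → P x → P y → x ≡ y) → AtMost 1 P
  atMost-1 eq {[]}         _ _ = z≤n
  atMost-1 eq {_ ∷ []}     _ _ = s≤s z≤n
  atMost-1 eq {_ ∷ _ ∷ _} ((x≢y ∷ _) ∷ _) (px ∷ py ∷ _) = contradiction (eq px py) x≢y

  atMost-2 : (∀ {x y z} → x ≢ y → x ≢ z → y ≢ z → P x → P y → P z → ⊥) → AtMost 2 P
  atMost-2 absurd {[]}             _ _ = z≤n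
  atMost-2 absurd {_ ∷ []}         _ _ = s≤s z≤n
  atMost-2 absurd {_ ∷ _ ∷ []}     _ _ = s≤s (s≤s z≤n)
  atMost-2 absurd {_ ∷ _ ∷ _ ∷ _} ((x≢y ∷ x≢z ∷ _) ∷ (y≢z ∷ _) ∷ _) (px ∷ py ∷ pz ∷ _)
    with () ← absurd x≢y x≢z y≢z px py pz

  private
    split : {xs : List A} → All (λ x → P x ⊎ Q x) xs →
            ∃[ ys ] ∃[ zs ] ys ⊑ xs × zs ⊑ xs × All P ys × All Q zs ×
              length xs ≡ length ys ℕ.+ length zs
    split [] = [] , [] , [] , [] , [] , [] , refl
    split (inj₁ p ∷ pqs) with ys , zs , s , t , ps , qs , e ← split pqs =
      _ ∷ ys , zs , refl ∷ s , _ ∷ʳ t , p ∷ ps , qs , cong suc e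
    split (inj₂ q ∷ pqs) with ys , zs , s , t , ps , qs , e ← split pqs =
      ys , _ ∷ zs , _ ∷ʳ s , refl ∷ t , ps , q ∷ qs ,
      trans (cong suc e) (sym (ℕ.+-suc (length ys) (length zs)))

  atMost-⊎ : AtMost k P → AtMost l Q → (∀ {x} → R x → P x ⊎ Q x) → AtMost (k ℕ.+ l) R
  atMost-⊎ ps qs R⊆ u rs with _ , _ , s , t , p , q , e ← split (All.map R⊆ rs) =
    ℕ.≤-trans (ℕ.≤-reflexive e) (ℕ.+-mono-≤ (ps (Unique-resp-⊒ s u) p) (qs (Unique-resp-⊒ t u) q))

  atMost-any : {F : A → B → Set ℓ} (ys : List B) → (∀ {y} → y ∈ ys → AtMost k (λ x → F x y)) →
               (∀ {x} → P x → Any (F x) ys) → AtMost (length ys ℕ.* k) P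
  atMost-any []       f c = atMost-0 (λ p → contradiction (c p) λ ())
  atMost-any (y ∷ ys) f c = atMost-⊎ (f (here refl)) (atMost-any ys (f ∘ there) id) (Any.toSum ∘ c)

  -- The image may depend on the proof of `P x`; thus the index of an element of a sized subset can
  -- serve as its image.
  atMost-image : (f : ∀ {x} → P x → B) → (∀ {x y} (px : P x) (py : P y) → f px ≡ f py → x ≡ y) →
                 (∀ {x} (px : P x) → Q (f px)) → AtMost k Q → AtMost k P
  atMost-image {P = P} {B = B} f inj f∈Q few u ps =
    subst (_≤ _) (length-reduce ps) (few (unique-reduce u ps) (all-reduce ps))
    where
    reduce : ∀ {xs} → All P xs → List B
    reduce = All.reduce f
    length-reduce : ∀ {xs} (ps : All P xs) → length (reduce ps) ≡ length xs
    length-reduce []       = refl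
    length-reduce (_ ∷ ps) = cong suc (length-reduce ps)
    all-reduce : ∀ {xs} (ps : All P xs) → All _ (reduce ps)
    all-reduce []       = []
    all-reduce (p ∷ ps) = f∈Q p ∷ all-reduce ps
    distinct : ∀ {x xs} (p : P x) → All (x ≢_) xs → (ps : All P xs) → All (f p ≢_) (reduce ps)
    distinct p []         []       = []
    distinct p (x≢y ∷ ds) (q ∷ ps) = (x≢y ∘ inj p q) ∷ distinct p ds ps
    unique-reduce : ∀ {xs} → Unique xs → (ps : All P xs) → Unique (reduce ps)
    unique-reduce []       []       = []
    unique-reduce (d ∷ us) (p ∷ ps) = distinct p d ps ∷ unique-reduce us ps

  record Finite (A : Set a) : Set a where
    field
      elements : List A
      unique   : Unique elements
      complete : ∀ x → x ∈ elements

    size : ℕ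
    size = length elements

    size≤ : {P : A → Set ℓ} → (∀ x → P x) → AtMost k P → size ≤ k
    size≤ all p = p unique (All.universal all elements)

    any? : {P : A → Set ℓ} → Decidable P → Dec (∃[ x ] P x)
    any? P? = map′ Any.satisfied (λ (x , px) → Any.map (λ { refl → px }) (complete x)) (Any.any? P? elements)

    atMost-size : {P : A → Set ℓ} → AtMost size P
    atMost-size = atMost-≤ (ℕ.≤-reflexive (ℕ.*-identityʳ size))
      (atMost-any {F = _≡_} elements (λ _ → atMost-1 λ { refl refl → refl }) λ {x} _ → complete x)

    module _ {P : A → Set ℓ} (P? : Decidable P) where

      select : List A
      select = filter P? elements

      select-unique : Unique select
      select-unique = Unique.filter⁺ P? unique

      select-all : All P select
      select-all = All.all-filter P? elements

      select-complete : ∀ {x} → P x → x ∈ select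
      select-complete px = ∈.∈-filter⁺ P? (complete _) px

      -- The double count behind most bounds below. The base `P` is listed and therefore decidable;
      -- the counted predicate `Q` may be arbitrary.
      atMost-fibres : {B : Set b} {Q : B → Set r} {F : B → A → Set t} → AtMost n P →
                      (∀ {x} → P x → AtMost k (λ y → F y x)) →
                      (∀ {y} → Q y → ∃[ x ] (P x × F y x)) →
                      AtMost (n ℕ.* k) Q
      atMost-fibres {k = k} p f c =
        atMost-≤ (ℕ.*-monoˡ-≤ k (p select-unique select-all))
          (atMost-any select (λ x∈ → f (All.lookup select-all x∈)) λ q →
            let x , px , Fyx = c q in Any.map (λ { refl → Fyx }) (select-complete px))

  open Finite

  finite-Fin : ∀ n → Finite (Fin n)
  finite-Fin n = record
    { elements = allFin n ; unique = Unique.allFin⁺ n ; complete = ∈.∈-allFin }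

  size-Fin : ∀ n → size (finite-Fin n) ≡ n
  size-Fin n = length-tabulate id

  finite-× : {A : Set a} {B : Set b} → Finite A → Finite B → Finite (A × B)
  finite-× X Y = record
    { elements = cartesianProduct (elements X) (elements Y)
    ; unique   = Unique.cartesianProduct⁺ (unique X) (unique Y)
    ; complete = λ (x , y) → ∈.∈-cartesianProduct⁺ (complete X x) (complete Y y) }

  length-cartesianProduct : (xs : List A) (ys : List B) →
                            length (cartesianProduct xs ys) ≡ length xs ℕ.* length ys
  length-cartesianProduct []       ys = refl
  length-cartesianProduct (x ∷ xs) ys = trans (length-++ (map (x ,_) ys))
    (cong₂ ℕ._+_ (length-map (x ,_) ys) (length-cartesianProduct xs ys))

  size-× : {A : Set a} {B : Set b} (X : Finite A) (Y : Finite B) →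
           size (finite-× X Y) ≡ size X ℕ.* size Y
  size-× X Y = length-cartesianProduct (elements X) (elements Y)

-- Finite fields: Fermat's theorem and the characteristic.

module Fields {A : Set} {add mul : Op₂ A} {neg : Op₁ A} {nul one : A}
  (isCommutativeRing : IsCommutativeRing _≡_ add mul neg nul one)
  (_≟_ : DecidableEquality A) (1≢0 : one ≢ nul)
  (inverse : ∀ {x} → x ≢ nul → ∃[ y ] mul x y ≡ one) where

  commutativeRing : CommutativeRing _ _
  commutativeRing = record { isCommutativeRing = isCommutativeRing }

  open CommutativeRing commutativeRing public
    using ( _+_; _*_; -_; 0#; 1#; ring; semiring; +-comm; +-assoc; *-comm; *-assoc; +-identityˡ; +-identityʳ
          ; *-identityˡ; *-identityʳ; zeroˡ; zeroʳ; distribˡ; distribʳ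
          ; +-commutativeMonoid; *-commutativeMonoid; -‿inverseʳ; -‿inverseˡ; +-monoid)
  open Exp semiring public using (_^_; ^-homo-*; ^-assocʳ)
  open RingProperties ring public using (+-cancelˡ)
  open Mult +-monoid public using () renaming (_×_ to _·_; ×-homo-+ to ·-homo-+)
  open ≡-Reasoning

  *-cancelˡ : ∀ {x y z} → x ≢ 0# → x * y ≡ x * z → y ≡ z
  *-cancelˡ {x} {y} {z} x≢0 eq = begin
    y             ≡⟨ rescale y ⟨
    w * (x * y)   ≡⟨ cong (w *_) eq ⟩
    w * (x * z)   ≡⟨ rescale z ⟩
    z             ∎
    where
    w = proj₁ (inverse x≢0)
    rescale : ∀ t → w * (x * t) ≡ t
    rescale t = begin
      w * (x * t)   ≡⟨ *-assoc w x t ⟨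
      w * x * t     ≡⟨ cong (_* t) (trans (*-comm w x) (proj₂ (inverse x≢0))) ⟩
      1# * t        ≡⟨ *-identityˡ t ⟩
      t             ∎

  x*y≡0⇒y≡0 : ∀ {x y} → x ≢ 0# → x * y ≡ 0# → y ≡ 0#
  x*y≡0⇒y≡0 {x} x≢0 eq = *-cancelˡ x≢0 (trans eq (sym (zeroʳ x)))

  x*y≢0 : ∀ {x y} → x ≢ 0# → y ≢ 0# → x * y ≢ 0#
  x*y≢0 x≢0 y≢0 = y≢0 ∘ x*y≡0⇒y≡0 x≢0

  x^n≢0 : ∀ {x} n → x ≢ 0# → x ^ n ≢ 0#
  x^n≢0 zero    x≢0 = 1≢0
  x^n≢0 (suc n) x≢0 = x*y≢0 x≢0 (x^n≢0 n x≢0)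

  private
    module ∏ = Sum *-commutativeMonoid
    module ∑ = Sum +-commutativeMonoid

  -- Translation by `a` permutes the entries of `e`, so their sum stays the same although it grows
  -- by `n · a`.
  n·a≡0 : ∀ {n} (e : Fin n → A) (π : Permutation′ n) {a} →
          (∀ i → e (π ⟨$⟩ʳ i) ≡ a + e i) → n · a ≡ 0#
  n·a≡0 {n} e π {a} shift = +-cancelˡ (∑.sum e) (n · a) 0# (begin
    ∑.sum e + n · a                        ≡⟨ +-comm _ _ ⟩
    n · a + ∑.sum e                        ≡⟨ cong (_+ ∑.sum e) (∑.sum-replicate n) ⟨
    ∑.sum {n} (λ _ → a) + ∑.sum e          ≡⟨ ∑.∑-distrib-+ (λ _ → a) e ⟨
    ∑.sum (λ i → a + e i)                  ≡⟨ ∑.sum-cong-≗ shift ⟨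
    ∑.sum (λ i → e (π ⟨$⟩ʳ i))             ≡⟨ ∑.sum-permute e π ⟨
    ∑.sum e                                ≡⟨ +-identityʳ _ ⟨
    ∑.sum e + 0#                           ∎)

  ∏≢0 : ∀ {n} (e : Fin n → A) → (∀ i → e i ≢ 0#) → ∏.sum e ≢ 0#
  ∏≢0 {zero}  e e≢0 = 1≢0
  ∏≢0 {suc n} e e≢0 = x*y≢0 (e≢0 Fin.zero) (∏≢0 (e ∘ Fin.suc) (e≢0 ∘ Fin.suc))

  -- Multiplication by `a` permutes the nonzero entries of `e`, and their product can be cancelled.
  -- An enumeration in place of the whole field makes this applicable to subfields.
  a^n≡a : ∀ {n} (e : Fin n → A) (π : Permutation′ n) {a} → a ≢ 0# →
          (∀ i → e (π ⟨$⟩ʳ i) ≡ a * e i) →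
          ∀ {o} → e o ≡ 0# → (∀ {i} → e i ≡ 0# → i ≡ o) → a ^ n ≡ a
  a^n≡a {suc n} e π {a} a≢0 shift {o} eo≡0 o-unique = trans (cong (a *_) a^n≡1) (*-identityʳ a)
    where
    on≢0 : A → A → A
    on≢0 z x with x ≟ 0#
    ... | yes _ = 1#
    ... | no  _ = z
    on≢0-0 : ∀ z {x} → x ≡ 0# → on≢0 z x ≡ 1#
    on≢0-0 z {x} x≡0 with x ≟ 0#
    ... | yes _  = refl
    ... | no x≢0 = contradiction x≡0 x≢0
    on≢0-≢0 : ∀ z {x} → x ≢ 0# → on≢0 z x ≡ z
    on≢0-≢0 z {x} x≢0 with x ≟ 0#
    ... | yes x≡0 = contradiction x≡0 x≢0
    ... | no _    = refl
    -- With its single zero replaced by 1 the product can run over all indices; the factor `a` is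
    -- suppressed at `o`, which leaves one power of `a` fewer than there are entries.
    nz : A → A
    nz x = on≢0 x x
    nz≢0 : ∀ x → nz x ≢ 0#
    nz≢0 x with x ≟ 0#
    ... | yes _  = 1≢0
    ... | no x≢0 = x≢0
    nz-* : ∀ x → nz (a * x) ≡ on≢0 a x * nz x
    nz-* x with x ≟ 0#
    ... | yes refl = trans (on≢0-0 _ (zeroʳ a)) (sym (*-identityʳ 1#))
    ... | no x≢0   = on≢0-≢0 _ (x*y≢0 a≢0 x≢0)
    Π = ∏.sum (nz ∘ e)
    a^n≡1 : a ^ n ≡ 1#
    a^n≡1 = *-cancelˡ (∏≢0 (nz ∘ e) (nz≢0 ∘ e)) (begin
      Π * a ^ n                               ≡⟨ *-comm _ _ ⟩
      a ^ n * Π                               ≡⟨ cong (_* Π) (∏.sum-replicate n) ⟨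
      ∏.sum {n} (λ _ → a) * Π                 ≡⟨ cong (_* Π) (*-identityˡ _) ⟨
      1# * ∏.sum {n} (λ _ → a) * Π            ≡⟨ cong (_* Π) (cong₂ _*_ (sym (on≢0-0 a eo≡0))
        (∏.sum-cong-≗ (λ i → sym (on≢0-≢0 a (Fin.punchInᵢ≢i o i ∘ o-unique))))) ⟩
      on≢0 a (e o) * ∏.sum (λ i → on≢0 a (e (punchIn o i))) * Π
                                              ≡⟨ cong (_* Π) (∏.sum-remove {i = o} (on≢0 a ∘ e)) ⟨
      ∏.sum (on≢0 a ∘ e) * Π                  ≡⟨ ∏.∑-distrib-+ (on≢0 a ∘ e) (nz ∘ e) ⟨
      ∏.sum (λ i → on≢0 a (e i) * nz (e i))   ≡⟨ ∏.sum-cong-≗ (λ i → trans (cong nz (shift i)) (nz-* (e i))) ⟨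
      ∏.sum (λ i → nz (e (π ⟨$⟩ʳ i)))         ≡⟨ ∏.sum-permute (nz ∘ e) π ⟨
      Π                                       ≡⟨ *-identityʳ Π ⟨
      Π * 1#                                  ∎)

  -- The multiple is the k-th power of 1 + 1, and there are no zero divisors.
  2^k·1≡0⇒1+1≡0 : ∀ k → (2 ℕ.^ k) · 1# ≡ 0# → 1# + 1# ≡ 0#
  2^k·1≡0⇒1+1≡0 zero    e = contradiction (trans (sym (+-identityʳ 1#)) e) 1≢0
  2^k·1≡0⇒1+1≡0 (suc k) e with (1# + 1#) ≟ 0#
  ... | yes 1+1≡0 = 1+1≡0
  ... | no 1+1≢0  = 2^k·1≡0⇒1+1≡0 k (x*y≡0⇒y≡0 1+1≢0 (begin
    (1# + 1#) * n·1          ≡⟨ distribʳ n·1 1# 1# ⟩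
    1# * n·1 + 1# * n·1      ≡⟨ cong₂ _+_ (*-identityˡ n·1) (*-identityˡ n·1) ⟩
    n·1 + n·1                ≡⟨ ·-homo-+ 1# (2 ℕ.^ k) (2 ℕ.^ k) ⟨
    (2 ℕ.^ k ℕ.+ 2 ℕ.^ k) · 1#  ≡⟨ cong (λ m → (2 ℕ.^ k ℕ.+ m) · 1#) (ℕ.+-identityʳ (2 ℕ.^ k)) ⟨
    (2 ℕ.^ suc k) · 1#       ≡⟨ e ⟩
    0#                       ∎))
    where n·1 = (2 ℕ.^ k) · 1#

open Counting

-- The field of order q² in characteristic 2: conjugation, norm and polynomial functions.

record Char2Field : Set₁ where
  field
    {Carrier} : Set
    {add mul} : Op₂ Carrier
    {neg}     : Op₁ Carrier
    {nul one} : Carrier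
    isCommutativeRing : IsCommutativeRing _≡_ add mul neg nul one
    _≟_     : DecidableEquality Carrier
    1≢0     : one ≢ nul
    inverse : ∀ {x} → x ≢ nul → ∃[ y ] mul x y ≡ one

  open Fields isCommutativeRing _≟_ 1≢0 inverse public

  field
    1+1≡0  : 1# + 1# ≡ 0#
    finite : Finite Carrier
    h      : ℕ

  -- The exponent is `suc h`, so that 2 ^ h is q / 2, as the square root and the trace require.
  q : ℕ
  q = 2 ℕ.^ suc h

  field
    size≡q*q : Finite.size finite ≡ q ℕ.* q
    x^q*q≡x  : ∀ x → x ^ (q ℕ.* q) ≡ x

module Char2 (𝔽 : Char2Field) where

  open Char2Field 𝔽 public hiding (Carrier)
  open Char2Field 𝔽 using () renaming (Carrier to A)
  open ≡-Reasoning

  private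
    𝔽₂ : RawRing _ _
    𝔽₂ = record { Carrier = Bool ; _≈_ = _≡_ ; _+_ = _xor_ ; _*_ = _∧_ ; -_ = id ; 0# = false ; 1# = true }

    embed₂ : 𝔽₂ -Raw-AlmostCommutative⟶ fromCommutativeRing commutativeRing
    embed₂ = record
      { ⟦_⟧    = ⟦_⟧
      ; +-homo = λ { true true → sym 1+1≡0 ; true false → sym (+-identityʳ 1#) ; false y → sym (+-identityˡ _) }
      ; *-homo = λ { true y → sym (*-identityˡ _) ; false y → sym (zeroˡ _) }
      ; -‿homo = λ { true → -1≡1 ; false → sym (RingProperties.-0#≈0# ring) }
      ; 0-homo = refl
      ; 1-homo = refl
      }
      where
      ⟦_⟧ : Bool → A
      ⟦ true  ⟧ = 1#
      ⟦ false ⟧ = 0#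
      -1≡1 : 1# ≡ - 1#
      -1≡1 = +-cancelˡ 1# _ _ (trans 1+1≡0 (sym (-‿inverseʳ 1#)))

  -- Coefficients in 𝔽₂ make the ring solver decide identities of characteristic 2.
  open RingSolver 𝔽₂ (fromCommutativeRing commutativeRing) embed₂
    (λ x y → Maybe.map (cong (_-Raw-AlmostCommutative⟶_.⟦_⟧ embed₂)) (dec⇒maybe (x Bool.≟ y)))
    public using (solve; _:=_; _:+_; _:*_; _:^_; :-_; con)

  x+x≡0 : ∀ x → x + x ≡ 0#
  x+x≡0 = solve 1 (λ x → x :+ x := con false) refl

  +≡0⇒≡ : ∀ {x y} → x + y ≡ 0# → x ≡ y
  +≡0⇒≡ {x} {y} eq = begin
    x             ≡⟨ solve 2 (λ x y → x := (x :+ y) :+ y) refl x y ⟩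
    (x + y) + y   ≡⟨ cong (_+ y) eq ⟩
    0# + y        ≡⟨ +-identityˡ y ⟩
    y             ∎

  ≡⇒+≡0 : ∀ {x y} → x ≡ y → x + y ≡ 0#
  ≡⇒+≡0 refl = x+x≡0 _

  +-drop : ∀ {x y} s k → x ≡ y → s + k * (x + y) ≡ s
  +-drop {x} s k refl = solve 3 (λ s k x → s :+ k :* (x :+ x) := s) refl s k x

  -- Equations follow from equations by exhibiting the difference of the two sides of the
  -- former as a combination of those of the latter.
  combine₁ : ∀ {x y x₁ y₁} k₁ → x₁ ≡ y₁ → x + y ≡ k₁ * (x₁ + y₁) → x ≡ y
  combine₁ k₁ refl eq = +≡0⇒≡ (trans eq (trans (cong (k₁ *_) (x+x≡0 _)) (zeroʳ k₁)))

  combine₂ : ∀ {x y x₁ y₁ x₂ y₂} k₁ k₂ → x₁ ≡ y₁ → x₂ ≡ y₂ →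
             x + y ≡ k₁ * (x₁ + y₁) + k₂ * (x₂ + y₂) → x ≡ y
  combine₂ {x₁ = x₁} {y₁} k₁ k₂ e₁ e₂ eq = combine₁ k₁ e₁ (trans eq (+-drop (k₁ * (x₁ + y₁)) k₂ e₂))

  combine₃ : ∀ {x y x₁ y₁ x₂ y₂ x₃ y₃} k₁ k₂ k₃ → x₁ ≡ y₁ → x₂ ≡ y₂ → x₃ ≡ y₃ →
             x + y ≡ k₁ * (x₁ + y₁) + k₂ * (x₂ + y₂) + k₃ * (x₃ + y₃) → x ≡ y
  combine₃ {x₁ = x₁} {y₁} {x₂} {y₂} k₁ k₂ k₃ e₁ e₂ e₃ eq =
    combine₂ k₁ k₂ e₁ e₂ (trans eq (+-drop (k₁ * (x₁ + y₁) + k₂ * (x₂ + y₂)) k₃ e₃))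

  inv : A → A
  inv x with x ≟ 0#
  ... | yes _  = 0#
  ... | no x≢0 = proj₁ (inverse x≢0)

  x*inv : ∀ {x} → x ≢ 0# → x * inv x ≡ 1#
  x*inv {x} x≢0 with x ≟ 0#
  ... | yes x≡0 = contradiction x≡0 x≢0
  ... | no x≢0′ = proj₂ (inverse x≢0′)

  x*y≡1⇒x≢0 : ∀ {x y} → x * y ≡ 1# → x ≢ 0#
  x*y≡1⇒x≢0 {y = y} eq refl = 1≢0 (trans (sym eq) (zeroˡ y))

  ^-distrib-* : ∀ x y n → (x * y) ^ n ≡ x ^ n * y ^ n
  ^-distrib-* x y zero    = sym (*-identityˡ 1#)
  ^-distrib-* x y (suc n) = begin
    x * y * (x * y) ^ n         ≡⟨ cong (x * y *_) (^-distrib-* x y n) ⟩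
    x * y * (x ^ n * y ^ n)     ≡⟨ solve 4 (λ x y u v → x :* y :* (u :* v) := x :* u :* (y :* v)) refl x y _ _ ⟩
    x * x ^ n * (y * y ^ n)     ∎

  x^2n≡x^n*x^n : ∀ x n → x ^ (2 ℕ.* n) ≡ x ^ n * x ^ n
  x^2n≡x^n*x^n x n = trans (cong (λ m → x ^ (n ℕ.+ m)) (ℕ.+-identityʳ n)) (^-homo-* x n n)

  frobenius : ∀ x y k → (x + y) ^ (2 ℕ.^ k) ≡ x ^ (2 ℕ.^ k) + y ^ (2 ℕ.^ k)
  frobenius x y zero    = solve 2 (λ x y → (x :+ y) :^ 1 := x :^ 1 :+ y :^ 1) refl x y
  frobenius x y (suc k) = begin
    (x + y) ^ (2 ℕ.* n)            ≡⟨ x^2n≡x^n*x^n (x + y) n ⟩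
    (x + y) ^ n * (x + y) ^ n      ≡⟨ cong (λ z → z * z) (frobenius x y k) ⟩
    (x ^ n + y ^ n) * (x ^ n + y ^ n)
      ≡⟨ solve 2 (λ x y → (x :+ y) :* (x :+ y) := x :* x :+ y :* y) refl (x ^ n) (y ^ n) ⟩
    x ^ n * x ^ n + y ^ n * y ^ n  ≡⟨ cong₂ _+_ (x^2n≡x^n*x^n x n) (x^2n≡x^n*x^n y n) ⟨
    x ^ (2 ℕ.* n) + y ^ (2 ℕ.* n)  ∎
    where n = 2 ℕ.^ k

  1^n≡1 : ∀ n → 1# ^ n ≡ 1#
  1^n≡1 zero    = refl
  1^n≡1 (suc n) = trans (*-identityˡ _) (1^n≡1 n)

  x*x≡y*y⇒x≡y : ∀ {x y} → x * x ≡ y * y → x ≡ y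
  x*x≡y*y⇒x≡y {x} {y} eq with (x + y) ≟ 0#
  ... | yes x+y≡0 = +≡0⇒≡ x+y≡0
  ... | no x+y≢0  = contradiction (combine₁ 1# eq
    (solve 2 (λ x y → (x :+ y) :* (x :+ y) :+ con false := con true :* (x :* x :+ y :* y)) refl x y))
    (x*y≢0 x+y≢0 x+y≢0)

  -- The exponent is q² / 2.
  sqrt : A → A
  sqrt x = x ^ (2 ℕ.^ h ℕ.* q)

  sqrt*sqrt : ∀ x → sqrt x * sqrt x ≡ x
  sqrt*sqrt x = begin
    sqrt x * sqrt x                  ≡⟨ x^2n≡x^n*x^n x (2 ℕ.^ h ℕ.* q) ⟨
    x ^ (2 ℕ.* (2 ℕ.^ h ℕ.* q))      ≡⟨ cong (x ^_) (ℕ.*-assoc 2 (2 ℕ.^ h) q) ⟨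
    x ^ (q ℕ.* q)                    ≡⟨ x^q*q≡x x ⟩
    x                                ∎

  bar : A → A
  bar x = x ^ q

  norm : A → A
  norm x = x ^ suc q

  bar-+ : ∀ x y → bar (x + y) ≡ bar x + bar y
  bar-+ x y = frobenius x y (suc h)

  bar-* : ∀ x y → bar (x * y) ≡ bar x * bar y
  bar-* x y = ^-distrib-* x y q

  bar-bar : ∀ x → bar (bar x) ≡ x
  bar-bar x = trans (^-assocʳ x q q) (x^q*q≡x x)

  bar-1 : bar 1# ≡ 1#
  bar-1 = 1^n≡1 q

  bar-0 : bar 0# ≡ 0#
  bar-0 = +-cancelˡ (bar 0#) _ _
    (trans (sym (bar-+ 0# 0#)) (trans (cong bar (+-identityˡ 0#)) (sym (+-identityʳ _))))

  bar≢0 : ∀ {x} → x ≢ 0# → bar x ≢ 0#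
  bar≢0 = x^n≢0 q

  bar-injective : ∀ {x y} → bar x ≡ bar y → x ≡ y
  bar-injective eq = trans (sym (bar-bar _)) (trans (cong bar eq) (bar-bar _))

  bar-norm : ∀ x → bar (norm x) ≡ norm x
  bar-norm x = trans (bar-* x (bar x)) (trans (cong (bar x *_) (bar-bar x)) (*-comm _ _))

  norm-bar : ∀ x → norm (bar x) ≡ norm x
  norm-bar x = trans (cong (bar x *_) (bar-bar x)) (*-comm _ _)

  norm-* : ∀ x y → norm (x * y) ≡ norm x * norm y
  norm-* x y = ^-distrib-* x y (suc q)

  norm≢0 : ∀ {x} → x ≢ 0# → norm x ≢ 0#
  norm≢0 = x^n≢0 (suc q)

  norm≢0⇒≢0 : ∀ {x} → norm x ≢ 0# → x ≢ 0#
  norm≢0⇒≢0 n≢0 refl = n≢0 (zeroˡ _)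

  -- Poly d l f: f is a polynomial function of formal degree d whose coefficient of x ^ d is l.
  data Poly : ℕ → A → (A → A) → Set where
    constant : ∀ {l f} → (∀ x → f x ≡ l) → Poly 0 l f
    horner   : ∀ {d l f g} k → Poly d l g → (∀ x → f x ≡ x * g x + k) → Poly (suc d) l f

  poly-≗ : ∀ {d l f g} → (∀ x → f x ≡ g x) → Poly d l g → Poly d l f
  poly-≗ e (constant c)   = constant (λ x → trans (e x) (c x))
  poly-≗ e (horner k p c) = horner k p (λ x → trans (e x) (c x))

  poly-x : Poly 1 1# id
  poly-x = horner 0# (constant {f = λ _ → 1#} (λ _ → refl))
    (solve 1 (λ x → x := x :* con true :+ con false) refl)

  poly-k : ∀ k → Poly 0 k (λ _ → k)
  poly-k k = constant (λ _ → refl)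

  poly-suc : ∀ {d l f} → Poly d l f → Poly (suc d) 0# f
  poly-suc {l = l} (constant c) = horner l (constant {f = λ _ → 0#} (λ _ → refl)) (λ x → trans (c x)
    (solve 2 (λ x l → l := x :* con false :+ l) refl x l))
  poly-suc (horner k p c) = horner k (poly-suc p) c

  poly-raise : ∀ {d l f} k → Poly d l f → Poly (suc k ℕ.+ d) 0# f
  poly-raise zero    p = poly-suc p
  poly-raise (suc k) p = poly-suc (poly-raise k p)

  poly-< : ∀ {d e l f} → d ℕ.< e → Poly d l f → Poly e 0# f
  poly-< {d} {f = f} d<e p with k , refl ← ℕ.m≤n⇒∃[o]m+o≡n d<e =
    subst (λ n → Poly n 0# f) (cong suc (ℕ.+-comm k d)) (poly-raise k p)

  poly-+ : ∀ {d l m f g} → Poly d l f → Poly d m g → Poly d (l + m) (λ x → f x + g x)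
  poly-+ (constant c) (constant c′)       = constant (λ x → cong₂ _+_ (c x) (c′ x))
  poly-+ (horner {g = f} k p c) (horner {g = g} k′ p′ c′) = horner (k + k′) (poly-+ p p′) (λ x →
    trans (cong₂ _+_ (c x) (c′ x))
      (solve 5 (λ x f g k k′ → x :* f :+ k :+ (x :* g :+ k′) := x :* (f :+ g) :+ (k :+ k′)) refl
         x (f x) (g x) k k′))

  poly-+< : ∀ {d e l m f g} → Poly d l f → e ℕ.< d → Poly e m g → Poly d l (λ x → f x + g x)
  poly-+< p e<d p′ = subst (λ l → Poly _ l _) (+-identityʳ _) (poly-+ p (poly-< e<d p′))

  poly-scale : ∀ {d l f} k → Poly d l f → Poly d (k * l) (λ x → k * f x)
  poly-scale k (constant c)   = constant (λ x → cong (k *_) (c x))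
  poly-scale k (horner {g = g} k′ p c) = horner (k * k′) (poly-scale k p) (λ x →
    trans (cong (k *_) (c x)) (solve 4 (λ k x g k′ → k :* (x :* g :+ k′) := x :* (k :* g) :+ k :* k′)
        refl k x (g x) k′))

  poly-* : ∀ {d e l m f g} → Poly d l f → Poly e m g → Poly (d ℕ.+ e) (l * m) (λ x → f x * g x)
  poly-* {g = g} (constant {l = l} c) p′ = poly-≗ (λ x → cong (_* g x) (c x)) (poly-scale l p′)
  poly-* {e = e} {m = m} {g = g} (horner {d} {l} {g = f} k p c) p′ =
    poly-≗ (λ x → trans (cong (_* g x) (c x))
              (solve 4 (λ x f k g → (x :* f :+ k) :* g := (x :* (f :* g) :+ con false) :+ k :* g)
                  refl x (f x) k (g x)))
      (poly-+< (horner 0# (poly-* p p′) (λ _ → refl)) (s≤s (ℕ.m≤n+m e d)) (poly-scale k p′))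

  poly-^ : ∀ {d l f} n → Poly d l f → Poly (n ℕ.* d) (l ^ n) (λ x → f x ^ n)
  poly-^ zero    p = poly-k 1#
  poly-^ (suc n) p = poly-* p (poly-^ n p)

  poly-x^ : ∀ n → Poly n 1# (_^ n)
  poly-x^ n = subst₂ (λ d l → Poly d l (_^ n)) (ℕ.*-identityʳ n) (1^n≡1 n) (poly-^ n poly-x)

  -- Synthetic division by x - r = x + r. The quotient keeps the leading coefficient, on which the
  -- induction in `roots` relies.
  factor : ∀ {d l f} r → Poly (suc d) l f → ∃[ g ] Poly d l g × (∀ x → f x ≡ (x + r) * g x + f r)
  factor {zero} {l} r (horner {f = f} {g} k (constant c) e) = (λ _ → l) , poly-k l , λ x → begin
    f x                         ≡⟨ trans (e x) (cong (λ z → x * z + k) (c x)) ⟩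
    x * l + k                   ≡⟨ solve 4 (λ x l k r → x :* l :+ k := (x :+ r) :* l :+ (r :* l :+ k))
        refl x l k r ⟩
    (x + r) * l + (r * l + k)   ≡⟨ cong ((x + r) * l +_) (trans (e r) (cong (λ z → r * z + k) (c r))) ⟨
    (x + r) * l + f r           ∎
  factor {suc d} r (horner {f = f} {g} k p e) with g′ , p′ , e′ ← factor r p =
    (λ x → x * g′ x + g r) , horner (g r) p′ (λ _ → refl) , λ x → begin
    f x                                          ≡⟨ trans (e x) (cong (λ z → x * z + k) (e′ x)) ⟩
    x * ((x + r) * g′ x + g r) + k
      ≡⟨ solve 5 (λ x r u v k → x :* ((x :+ r) :* u :+ v) :+ k := (x :+ r) :* (x :* u :+ v) :+ (r :* v :+ k))
           refl x r (g′ x) (g r) k ⟩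
    (x + r) * (x * g′ x + g r) + (r * g r + k)   ≡⟨ cong ((x + r) * (x * g′ x + g r) +_) (e r) ⟨
    (x + r) * (x * g′ x + g r) + f r             ∎

  roots : ∀ {d l f} → Poly d l f → l ≢ 0# → AtMost d (λ x → f x ≡ 0#)
  roots p l≢0 {[]} _ _ = z≤n
  roots (constant c) l≢0 {r ∷ _} _ (fr ∷ _) = contradiction (trans (sym (c r)) fr) l≢0
  roots {f = f} p@(horner _ _ _) l≢0 {r ∷ rs} (r≢ ∷ u) (fr≡0 ∷ frs≡0)
    with g , p′ , e ← factor r p = s≤s (roots p′ l≢0 u (All.zipWith root (r≢ , frs≡0)))
    where
    root : ∀ {x} → (r ≢ x) × (f x ≡ 0#) → g x ≡ 0#
    root {x} (r≢x , fx≡0) = x*y≡0⇒y≡0 (r≢x ∘ sym ∘ +≡0⇒≡) (begin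
      (x + r) * g x         ≡⟨ +-identityʳ _ ⟨
      (x + r) * g x + 0#    ≡⟨ cong (_ +_) fr≡0 ⟨
      (x + r) * g x + f r   ≡⟨ e x ⟨
      f x                   ≡⟨ fx≡0 ⟩
      0#                    ∎)

-- The conic in normal form, and the quartic.

module Ovals (𝔽 : Char2Field) where

  open Char2Field 𝔽 using () renaming (Carrier to A)
  open Char2 𝔽
  open ≡-Reasoning

  -- The regular hyperoval with nucleus (x₀ , y₀) in coordinates centred at the nucleus.
  record Oval : Set where
    field
      x₀ y₀ a b c : A

    form : A → A → A
    form s t = a * (s * s) + s * t + b * (t * t)

    field
      -- The conic has no point at infinity, and the nucleus does not lie on it.
      anisotropic : ∀ {s t} → form s t ≡ 0# → s ≡ 0# × t ≡ 0#
      c≢0         : c ≢ 0#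

    Conic : A × A → Set
    Conic (x , y) = form (x + x₀) (y + y₀) ≡ c

    Hyperoval : A × A → Set
    Hyperoval p = p ≡ (x₀ , y₀) ⊎ Conic p

  module OvalProperties (𝒪 : Oval) where
    open Oval 𝒪

    a≢0 : a ≢ 0#
    a≢0 refl = 1≢0 (proj₁ (anisotropic {1#} {0#}
      (solve 1 (λ b → con false :* (con true :* con true) :+ con true :* con false
          :+ b :* (con false :* con false)
         := con false) refl b)))

    b≢0 : b ≢ 0#
    b≢0 refl = 1≢0 (proj₂ (anisotropic {0#} {1#}
      (solve 1 (λ a → a :* (con false :* con false) :+ con false :* con true
          :+ con false :* (con true :* con true)
         := con false) refl a)))

    poly-quadratic : ∀ k₂ k₁ k₀ → Poly 2 k₂ (λ v → k₂ * (v * v) + k₁ * v + k₀)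
    poly-quadratic k₂ k₁ k₀ = horner k₀ (horner k₁ (poly-k k₂) (λ _ → refl)) (λ v →
      solve 4 (λ v k₂ k₁ k₀ → k₂ :* (v :* v) :+ k₁ :* v :+ k₀ := v :* (v :* k₂ :+ k₁) :+ k₀) refl v k₂ k₁ k₀)

    poly-linear : ∀ k₁ k₀ → Poly 1 k₁ (λ v → k₁ * v + k₀)
    poly-linear k₁ k₀ = horner k₀ (poly-k k₁) (λ v → cong (_+ k₀) (*-comm k₁ v))

    conic-vertical : ∀ x → AtMost 2 (λ p → proj₁ p ≡ x × Conic p)
    conic-vertical x = atMost-image (λ {p} _ → proj₂ p) (λ { (refl , _) (refl , _) refl → refl })
      (λ { {_ , y} (refl , on) → trans (solve 7 (λ a b c x x₀ y₀ y →
                b :* (y :* y) :+ (x :+ x₀) :* y :+ (a :* ((x :+ x₀) :* (x :+ x₀)) :+ (x :+ x₀) :* y₀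
                    :+ b :* (y₀ :* y₀) :+ c)
                := a :* ((x :+ x₀) :* (x :+ x₀)) :+ (x :+ x₀) :* (y :+ y₀)
                    :+ b :* ((y :+ y₀) :* (y :+ y₀)) :+ c)
              refl a b c x x₀ y₀ y) (≡⇒+≡0 on) })
      (roots (poly-quadratic b (x + x₀) (form (x + x₀) y₀ + c)) b≢0)

    -- If ‖v‖ = ‖x‖ and m̄ v + m x = d for some m, where d = y + yₚ, then d v̄ = d̄ x.
    module Transversal (x yₚ : A) (x≢0 : x ≢ 0#) where

      t₀ = yₚ + y₀
      k  = form x₀ t₀ + c
      x̄  = bar x

      -- `γ` and `α` are the leading coefficients of `D` and `N` below.
      ν p γ α : A
      ν = x * x̄
      p = bar b * (x̄ * x̄)
      γ = p + b * (x̄ * bar x₀)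
      α = p * a + b * bar k

      -- With d = y + yₚ, the equation of the conic is b d² + S v d + C v = 0, and its image under
      -- bar becomes p d² + S′ v d + C′ v = 0 when v̄ and d̄ are replaced by ‖x‖ / v and d x̄ / v.
      S C S′ C′ D N : A → A
      S v  = v + x₀
      C v  = a * (v * v) + t₀ * v + k
      S′ v = x̄ * bar x₀ * v + x̄ * ν
      C′ v = bar k * (v * v) + bar t₀ * ν * v + bar a * (ν * ν)
      D v  = p * S v + b * S′ v
      N v  = p * C v + b * C′ v

      -- The slope m has been eliminated, so that these are conditions on the point alone.
      Meets : A × A → Set
      Meets p@(v , y) = Conic p × norm v ≡ norm x × (y + yₚ) * bar v ≡ bar (y + yₚ) * x

      module _ {v y : A} (m : Meets (v , y)) where
        private
          d = y + yₚ
          on  = proj₁ m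
          nrm = proj₁ (proj₂ m)
          tw  = proj₂ (proj₂ m)

        conic-eq : b * (d * d) + S v * d + C v ≡ 0#
        conic-eq = trans (solve 8 (λ a b c x₀ y₀ v y yₚ →
            let t₀ = yₚ :+ y₀
                k = a :* (x₀ :* x₀) :+ x₀ :* t₀ :+ b :* (t₀ :* t₀) :+ c
                d = y :+ yₚ
                s = v :+ x₀
                t = y :+ y₀
            in b :* (d :* d) :+ s :* d :+ (a :* (v :* v) :+ t₀ :* v :+ k)
               := a :* (s :* s) :+ s :* t :+ b :* (t :* t) :+ c) refl a b c x₀ y₀ v y yₚ) (≡⇒+≡0 on)

        conic-eq-bar : bar b * (bar d * bar d) + (bar v + bar x₀) * bar d +
                       (bar a * (bar v * bar v) + bar t₀ * bar v + bar k) ≡ 0#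
        conic-eq-bar = begin
          _ ≡⟨ cong₂ _+_ (cong₂ _+_ (bar-*² b d) (trans (bar-* _ d) (cong (_* bar d) (bar-+ v x₀))))
                 (trans (bar-+ _ k) (cong (_+ bar k) (trans (bar-+ _ _)
                     (cong₂ _+_ (bar-*² a v) (bar-* t₀ v))))) ⟨
          bar (b * (d * d)) + bar ((v + x₀) * d) + bar (C v)
            ≡⟨ trans (bar-+ _ (C v)) (cong (_+ bar (C v)) (bar-+ _ _)) ⟨
          bar (b * (d * d) + (v + x₀) * d + C v)  ≡⟨ cong bar conic-eq ⟩
          bar 0#                                  ≡⟨ bar-0 ⟩
          0#                                      ∎
          where
          bar-*² : ∀ p q → bar (p * (q * q)) ≡ bar p * (bar q * bar q)
          bar-*² p q = trans (bar-* p _) (cong (bar p *_) (bar-* q q))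

        d̄v≡dx̄ : bar d * v ≡ d * x̄
        d̄v≡dx̄ = *-cancelˡ x≢0 (combine₂ v d tw nrm
          (solve 6 (λ x x̄ v v̄ d d̄ → x :* (d̄ :* v) :+ x :* (d :* x̄)
             := v :* (d :* v̄ :+ d̄ :* x) :+ d :* (v :* v̄ :+ x :* x̄)) refl x x̄ v (bar v) d (bar d)))

        -- Multiplying `conic-eq-bar` by v² pairs every conjugate with a factor `v`, and v v̄ and d̄
        -- v are known.
        conic-eq′ : p * (d * d) + S′ v * d + C′ v ≡ 0#
        conic-eq′ = begin
          p * (d * d) + S′ v * d + C′ v
            ≡⟨ cong₂ _+_ (solve 6 (λ b̄ x̄ x̄₀ v ν d → b̄ :* (x̄ :* x̄) :* (d :* d)
                :+ (x̄ :* x̄₀ :* v :+ x̄ :* ν) :* d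
                 := b̄ :* (d :* x̄ :* (d :* x̄)) :+ (ν :+ x̄₀ :* v) :* (d :* x̄))
                     refl (bar b) x̄ (bar x₀) v ν d) refl ⟩
          bar b * (d * x̄ * (d * x̄)) + (ν + bar x₀ * v) * (d * x̄) + C′ v
            ≡⟨ cong₂ (λ e μ → bar b * (e * e) + (μ + bar x₀ * v) * e +
                               (bar k * (v * v) + bar t₀ * μ * v + bar a * (μ * μ))) d̄v≡dx̄ nrm ⟨
          bar b * (d̄ * v * (d̄ * v)) + (v * v̄ + bar x₀ * v) * (d̄ * v) +
            (bar k * (v * v) + bar t₀ * (v * v̄) * v + bar a * (v * v̄ * (v * v̄)))
            ≡⟨ cong₂ _+_
                 (solve 5 (λ b̄ x̄₀ v v̄ d̄ → b̄ :* (d̄ :* v :* (d̄ :* v)) :+ (v :* v̄ :+ x̄₀ :* v) :* (d̄ :* v)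
                   := v :* v :* (b̄ :* (d̄ :* d̄) :+ (v̄ :+ x̄₀) :* d̄)) refl (bar b) (bar x₀) v v̄ d̄)
                 (solve 5 (λ ā t̄₀ k̄ v v̄ → k̄ :* (v :* v) :+ t̄₀ :* (v :* v̄) :* v
                     :+ ā :* (v :* v̄ :* (v :* v̄))
                   := v :* v :* (ā :* (v̄ :* v̄) :+ t̄₀ :* v̄ :+ k̄)) refl (bar a) (bar t₀) (bar k) v v̄) ⟩
          v * v * (bar b * (d̄ * d̄) + (v̄ + bar x₀) * d̄) + v * v * (bar a * (v̄ * v̄) + bar t₀ * v̄ + bar k)
            ≡⟨ distribˡ (v * v) _ _ ⟨
          v * v * (bar b * (d̄ * d̄) + (v̄ + bar x₀) * d̄ + (bar a * (v̄ * v̄) + bar t₀ * v̄ + bar k))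
            ≡⟨ trans (cong (v * v *_) conic-eq-bar) (zeroʳ _) ⟩
          0# ∎
          where
          d̄ = bar d
          v̄ = bar v

        -- In `p` times `conic-eq` plus `b` times `conic-eq′` the terms in d² cancel.
        Dd≡N : D v * d ≡ N v
        Dd≡N = combine₂ p b conic-eq conic-eq′
          (solve 7 (λ p b S S′ C C′ d → (p :* S :+ b :* S′) :* d :+ (p :* C :+ b :* C′)
             := p :* (b :* (d :* d) :+ S :* d :+ C :+ con false)
                 :+ b :* (p :* (d :* d) :+ S′ :* d :+ C′ :+ con false))
             refl p b (S v) (S′ v) (C v) (C′ v) d)

        -- `conic-eq` multiplied by the square of `D v`; then d occurs only in `D v * d`, which is
        -- `N v`.
        quartic : b * (N v * N v) + S v * (N v * D v) + C v * (D v * D v) ≡ 0#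
        quartic = begin
          b * (N v * N v) + S v * (N v * D v) + C v * (D v * D v)
            ≡⟨ cong (λ n → b * (n * n) + S v * (n * D v) + C v * (D v * D v)) Dd≡N ⟨
          b * (D v * d * (D v * d)) + S v * (D v * d * D v) + C v * (D v * D v)
            ≡⟨ solve 5 (λ b s C D d → b :* (D :* d :* (D :* d)) :+ s :* (D :* d :* D) :+ C :* (D :* D)
                 := D :* D :* (b :* (d :* d) :+ s :* d :+ C)) refl b (S v) (C v) (D v) d ⟩
          D v * D v * (b * (d * d) + S v * d + C v)
            ≡⟨ trans (cong (D v * D v *_) conic-eq) (zeroʳ _) ⟩
          0# ∎

      γ≡0⇒b̄x̄≡bx̄₀ : γ ≡ 0# → bar b * x̄ ≡ b * bar x₀
      γ≡0⇒b̄x̄≡bx̄₀ γ≡0 = *-cancelˡ (bar≢0 x≢0) (combine₁ 1# γ≡0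
        (solve 4 (λ b b̄ x̄ x̄₀ → x̄ :* (b̄ :* x̄) :+ x̄ :* (b :* x̄₀)
          := con true :* (b̄ :* (x̄ :* x̄) :+ b :* (x̄ :* x̄₀) :+ con false)) refl b (bar b) x̄ (bar x₀)))

      -- The constant term of `D` is x̄² (b̄ x₀ + b x), and b x = b̄ x₀ is the conjugate of the
      -- relation that γ = 0 expresses.
      γ≡0⇒D≡0 : γ ≡ 0# → ∀ v → D v ≡ 0#
      γ≡0⇒D≡0 γ≡0 v = combine₂ v (x̄ * x̄) γ≡0 conj
        (trans (solve 7 (λ b x x̄ x₀ x̄₀ v p → p :* (v :+ x₀)
            :+ b :* (x̄ :* x̄₀ :* v :+ x̄ :* (x :* x̄)) :+ con false
           := v :* (p :+ b :* (x̄ :* x̄₀) :+ con false) :+ (p :* x₀ :+ x̄ :* x̄ :* (b :* x)))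
           refl b x x̄ x₀ (bar x₀) v p)
         (cong (v * (γ + 0#) +_) (solve 5 (λ b b̄ x x̄ x₀ → b̄ :* (x̄ :* x̄) :* x₀ :+ x̄ :* x̄ :* (b :* x)
           := x̄ :* x̄ :* (b :* x :+ b̄ :* x₀)) refl b (bar b) x x̄ x₀)))
        where
        conj : b * x ≡ bar b * x₀
        conj = begin
          b * x                    ≡⟨ cong₂ _*_ (bar-bar b) (bar-bar x) ⟨
          bar (bar b) * bar x̄      ≡⟨ bar-* (bar b) x̄ ⟨
          bar (bar b * x̄)          ≡⟨ cong bar (γ≡0⇒b̄x̄≡bx̄₀ γ≡0) ⟩
          bar (b * bar x₀)         ≡⟨ trans (bar-* b (bar x₀)) (cong (bar b *_) (bar-bar x₀)) ⟩
          bar b * x₀               ∎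

      poly-D : Poly 1 γ D
      poly-D = poly-≗ (λ v → solve 7 (λ b x̄ x₀ x̄₀ v p ν → p :* (v :+ x₀) :+ b :* (x̄ :* x̄₀ :* v :+ x̄ :* ν)
          := (p :+ b :* (x̄ :* x̄₀)) :* v :+ (p :* x₀ :+ b :* (x̄ :* ν))) refl b x̄ x₀ (bar x₀) v p ν)
        (poly-linear γ (p * x₀ + b * (x̄ * ν)))

      poly-C : Poly 2 a C
      poly-C = poly-quadratic a t₀ k

      poly-N : Poly 2 α N
      poly-N = poly-+ (poly-scale p poly-C) (poly-scale b
          (poly-quadratic (bar k) (bar t₀ * ν) (bar a * (ν * ν))))

      -- 6 = 4 + 1 · 2. Where `D v` is nonzero, v is a zero of the quartic and determines y; above
      -- the single zero of `D` there are at most two points of the conic.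
      meets-γ≢0 : γ ≢ 0# → AtMost 6 Meets
      meets-γ≢0 γ≢0 = atMost-⊎ {P = λ m → Meets m × D (proj₁ m) ≢ 0#} {Q = λ m → Meets m × D (proj₁ m) ≡ 0#}
        (atMost-image (λ {m} _ → proj₁ m)
          (λ { {v , y} {_ , y′} (m , Dv≢0) (m′ , _) refl → cong (v ,_)
                 (+-cancelˡ yₚ y y′ (trans (+-comm yₚ y) (trans
                     (*-cancelˡ Dv≢0 (trans (Dd≡N m) (sym (Dd≡N m′)))) (+-comm y′ yₚ)))) })
          (quartic ∘ proj₁)
          (roots (poly-+ (poly-+ (poly-scale b (poly-* poly-N poly-N)) (poly-* poly-S (poly-* poly-N poly-D)))
                         (poly-* poly-C (poly-* poly-D poly-D))) lead≢0))
        (Finite.atMost-fibres finite (λ v → D v ≟ 0#) (roots poly-D γ≢0) (λ _ → conic-vertical _)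
          (λ { (m , Dv≡0) → _ , Dv≡0 , refl , proj₁ m }))
        (λ { {v , _} m → case D v ≟ 0# of λ { (yes e) → inj₂ (m , e) ; (no ne) → inj₁ (m , ne) } })
        where
        poly-S : Poly 1 1# S
        poly-S = poly-+< poly-x (s≤s z≤n) (poly-k x₀)
        -- This is the value of `form` at (γ, α).
        lead≢0 : b * (α * α) + 1# * (α * γ) + a * (γ * γ) ≢ 0#
        lead≢0 e = γ≢0 (proj₁ (anisotropic (trans
          (solve 4 (λ a b α γ → a :* (γ :* γ) :+ γ :* α :+ b :* (α :* α)
             := b :* (α :* α) :+ con true :* (α :* γ) :+ a :* (γ :* γ)) refl a b α γ) e)))

      -- As `D` vanishes identically, v is a zero of the quadratic `N`: two abscissae with two
      -- points each.
      meets-γ≡0 : γ ≡ 0# → α ≢ 0# → AtMost 4 Meets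
      meets-γ≡0 γ≡0 α≢0 = Finite.atMost-fibres finite (λ v → N v ≟ 0#) (roots poly-N α≢0)
          (λ _ → conic-vertical _)
        (λ { {v , y} m → v , trans (sym (Dd≡N m)) (trans (cong (_* (y + yₚ)) (γ≡0⇒D≡0 γ≡0 v)) (zeroˡ _))
            , refl , proj₁ m })

module Arithmetic where

  open +-*-Solver

  -- For q = 2 + m: zero, q elements of one norm and q + 1 elements for each of q - 2 other norms
  -- are q² - 1 elements altogether.
  [2+m]² : ∀ m → suc (1 ℕ.+ (2 ℕ.+ m ℕ.+ m ℕ.* (3 ℕ.+ m))) ≡ (2 ℕ.+ m) ℕ.* (2 ℕ.+ m)
  [2+m]² = solve 1 (λ m → con 2 :+ (con 2 :+ m :+ m :* (con 3 :+ m)) := (con 2 :+ m) :* (con 2 :+ m)) refl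

  -- For q = 4 (2 + n + j) one has q² = 4 (n + j)(q + 1) + 7 q + 8, so that 4 n (q + 1) + 7 q falls
  -- short of q² by at least 8.
  [4[2+n+j]]² : ∀ n j → suc (n ℕ.* (suc (4 ℕ.* (2 ℕ.+ n ℕ.+ j)) ℕ.* 2) ℕ.+
                        (n ℕ.* (suc (4 ℕ.* (2 ℕ.+ n ℕ.+ j)) ℕ.* 2) ℕ.* 1 ℕ.+ 7 ℕ.* (4 ℕ.* (2 ℕ.+ n ℕ.+ j))))
                    ℕ.+ (7 ℕ.+ 4 ℕ.* j ℕ.* suc (4 ℕ.* (2 ℕ.+ n ℕ.+ j)))
                  ≡ 4 ℕ.* (2 ℕ.+ n ℕ.+ j) ℕ.* (4 ℕ.* (2 ℕ.+ n ℕ.+ j))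
  [4[2+n+j]]² = solve 2 (λ n j → let q = con 4 :* (con 2 :+ n :+ j) ; u = n :* ((con 1 :+ q) :* con 2) in
    con 1 :+ (u :+ (u :* con 1 :+ con 7 :* q)) :+ (con 7 :+ con 4 :* j :* (con 1 :+ q)) := q :* q) refl

-- Sizes of the fibres of the norm.

module Norms (𝔽 : Char2Field) where

  open Char2Field 𝔽 using () renaming (Carrier to A)
  open Char2 𝔽
  open ≡-Reasoning

  q≡2+ : ∃[ m ] q ≡ 2 ℕ.+ m
  q≡2+ with m , e ← ℕ.m≤n⇒∃[o]m+o≡n (ℕ.*-monoʳ-≤ 2 (ℕ.m^n>0 2 h)) = m , sym e

  norm-fibre : ∀ ν → AtMost (suc q) (λ x → norm x ≡ ν)
  norm-fibre ν = atMost-⊆ ≡⇒+≡0 (roots (poly-+< (poly-x^ (suc q)) (s≤s z≤n) (poly-k ν)) 1≢0)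

  bar-fixed : AtMost q (λ x → bar x ≡ x)
  bar-fixed = atMost-⊆ ≡⇒+≡0 (roots (poly-+< (poly-x^ q) 1<q poly-x) 1≢0)
    where
    1<q : 1 ℕ.< q
    1<q = ℕ.*-monoʳ-≤ 2 (ℕ.m^n>0 2 h)

  -- If a norm ν were attained at most q times, there would be fewer than 1 + (q - 1)(q + 1) elements.
  norm-fibre-large : ∀ {ν} → ν ≢ 0# → bar ν ≡ ν → ¬ AtMost q (λ x → norm x ≡ ν)
  norm-fibre-large {ν} ν≢0 ν̄≡ν few =
    ℕ.<⇒≱ (ℕ.≤-reflexive (trans (Arithmetic.[2+m]² m) (sym (cong₂ ℕ._*_ q≡2+m q≡2+m))))
        (subst₂ ℕ._≤_ size≡q*q refl
      (Finite.size≤ finite classify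
        (atMost-⊎ (atMost-1 {P = _≡ 0#} (λ { refl refl → refl }))
          (atMost-⊎ (atMost-≤ (ℕ.≤-reflexive q≡2+m) few)
            rest id) id)))
    where
    m = proj₁ q≡2+
    q≡2+m = proj₂ q≡2+
    classify : ∀ x → x ≡ 0# ⊎ (norm x ≡ ν ⊎ (x ≢ 0# × norm x ≢ ν))
    classify x with x ≟ 0# | norm x ≟ ν
    ... | yes e | _     = inj₁ e
    ... | no _  | yes e = inj₂ (inj₁ e)
    ... | no ¬e | no ¬f = inj₂ (inj₂ (¬e , ¬f))
    others : AtMost m (λ μ → bar μ ≡ μ × μ ≢ 0# × μ ≢ ν)
    -- 0 and `ν` are fixed by `bar` as well and may be put in front of the list.
    others u all = ℕ.≤-pred (ℕ.≤-pred (ℕ.≤-trans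
      (bar-fixed (((ν≢0 ∘ sym) ∷ All.map (λ { (_ , μ≢0 , _) → μ≢0 ∘ sym }) all) ∷
                   All.map (λ { (_ , _ , μ≢ν) → μ≢ν ∘ sym }) all ∷ u)
                 (bar-0 ∷ ν̄≡ν ∷ All.map proj₁ all))
      (ℕ.≤-reflexive q≡2+m)))
    rest : AtMost (m ℕ.* (3 ℕ.+ m)) (λ x → x ≢ 0# × norm x ≢ ν)
    rest = Finite.atMost-fibres finite (λ μ → (bar μ ≟ μ) ×-dec ¬? (μ ≟ 0#) ×-dec ¬? (μ ≟ ν)) others
      (λ {μ} _ → atMost-≤ (s≤s (ℕ.≤-reflexive q≡2+m)) (norm-fibre μ))
      (λ {x} (x≢0 , nx≢ν) → norm x , (bar-norm x , norm≢0 x≢0 , nx≢ν) , refl)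

-- The Artin-Schreier map and traces.

module ArtinSchreier (𝔽 : Char2Field) where

  open Char2Field 𝔽 using () renaming (Carrier to A)
  open Char2 𝔽
  open Norms 𝔽
  open ≡-Reasoning

  ℘ : A → A
  ℘ w = w * w + w

  -- By additivity w + w′ is a zero of `℘`, and the zeros are 0 and 1.
  ℘-injective : ∀ {w w′} → ℘ w ≡ ℘ w′ → w ≢ w′ → w ≡ w′ + 1#
  ℘-injective {w} {w′} eq w≢w′ = *-cancelˡ (w≢w′ ∘ +≡0⇒≡) (combine₁ 1# eq
    (solve 2 (λ w w′ → (w :+ w′) :* w :+ (w :+ w′) :* (w′ :+ con true)
       := con true :* ((w :* w :+ w) :+ (w′ :* w′ :+ w′))) refl w w′))

  -- The image of ℘ has index two.
  ℘-index : ∀ {a} → (∀ w → ℘ w ≢ a) → ∀ ζ → (∀ w → ℘ w + a ≢ ζ) → ∃[ w ] ℘ w ≡ ζ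
  ℘-index {a} ¬a ζ ¬a+ζ with Finite.any? finite (λ w → ℘ w ≟ ζ)
  ... | yes w = w
  ... | no ¬w = contradiction double (ℕ.<⇒≱ smaller)
    where
    bools : Finite Bool
    bools = record { elements = false ∷ true ∷ []
                   ; unique = ((λ ()) ∷ []) ∷ [] ∷ []
                   ; complete = λ { false → here refl ; true → there (here refl) } }
    -- If `ζ` were in neither coset, this map would miss `ζ` but take every value at most twice,
    -- which is impossible for a domain twice as large as the field.
    f : A × Bool → A
    f (w , β) = ℘ w + (if β then a else 0#)
    f≢ζ : ∀ p → f p ≢ ζ
    f≢ζ (w , true)  e = ¬a+ζ w e
    f≢ζ (w , false) e = ¬w (w , trans (sym (+-identityʳ _)) e)
    same : ∀ {w w′ β β′} → f (w , β) ≡ f (w′ , β′) → β ≡ β′ × ℘ w ≡ ℘ w′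
    same {β = true}  {true}  e = refl , combine₁ 1# e
      (solve 3 (λ x y a → x :+ y := con true :* ((x :+ a) :+ (y :+ a))) refl _ _ a)
    same {β = false} {false} e = refl , combine₁ 1# e
      (solve 2 (λ x y → x :+ y := con true :* ((x :+ con false) :+ (y :+ con false))) refl _ _)
    -- By additivity `a` would be the image of w + w′.
    same {w} {w′} {β = true}  {false} e = contradiction
        (combine₁ 1# e (solve 3 (λ w w′ a → ((w :+ w′) :* (w :+ w′) :+ (w :+ w′)) :+ a
      := con true :* ((w :* w :+ w :+ a) :+ (w′ :* w′ :+ w′ :+ con false))) refl w w′ a)) (¬a (w + w′))
    same {w} {w′} {β = false} {true}  e = contradiction
        (combine₁ 1# e (solve 3 (λ w w′ a → ((w :+ w′) :* (w :+ w′) :+ (w :+ w′)) :+ a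
      := con true :* ((w :* w :+ w :+ con false) :+ (w′ :* w′ :+ w′ :+ a))) refl w w′ a)) (¬a (w + w′))
    fibre : ∀ v → AtMost 2 (λ p → f p ≡ v)
    fibre v = atMost-2 {P = λ p → f p ≡ v} three
      where
      three : ∀ {x y z} → x ≢ y → x ≢ z → y ≢ z → f x ≡ v → f y ≡ v → f z ≡ v → ⊥
      three {w , β} {w′ , β′} {w″ , β″} x≢y x≢z y≢z ex ey ez
        with same {w} {w′} {β} {β′} (trans ex (sym ey)) | same {w} {w″} {β} {β″} (trans ex (sym ez))
      ... | refl , e | refl , e′ = y≢z (cong (_, β) (combine₂ 1# 1#
        (℘-injective e (x≢y ∘ cong (_, β))) (℘-injective e′ (x≢z ∘ cong (_, β)))
        (solve 3 (λ w w′ w″ → w′ :+ w″ := con true :* (w :+ (w′ :+ con true))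
            :+ con true :* (w :+ (w″ :+ con true)))
           refl w w′ w″)))
    n = Finite.size finite
    double : n ℕ.* 2 ℕ.≤ ℕ.pred n ℕ.* 2
    double = ℕ.≤-trans (ℕ.≤-reflexive (sym (size-× finite bools)))
        (Finite.size≤ (finite-× finite bools) (λ _ → _)
      (Finite.atMost-fibres finite (λ v → ¬? (v ≟ ζ))
        (λ u all → ℕ.<⇒≤pred (Finite.atMost-size finite {P = λ _ → ⊤} (All.map (_∘ sym) all ∷ u)
            (All.universal _ _)))
        (λ {v} _ → fibre v) (λ {p} (_ : ⊤) → f p , f≢ζ p , refl)))
    smaller : ℕ.pred n ℕ.* 2 ℕ.< n ℕ.* 2
    smaller rewrite size≡q*q with m , q≡2+m ← q≡2+ rewrite q≡2+m = ℕ.n≤1+n _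

  -- The sum u + u² + u⁴ + ... with last exponent 2 ^ j; for j = h it is the absolute trace on the
  -- subfield of order q.
  trace : ℕ → A → A
  trace zero    u = u
  trace (suc j) u = trace j u + u ^ (2 ℕ.^ suc j)

  trace-℘ : ∀ j v → trace j (℘ v) ≡ v ^ (2 ℕ.^ suc j) + v
  trace-℘ zero    v = solve 1 (λ v → v :* v :+ v := v :^ 2 :+ v) refl v
  trace-℘ (suc j) v = begin
    trace j (℘ v) + ℘ v ^ n             ≡⟨ cong₂ _+_ (trace-℘ j v) (frobenius (v * v) v (suc j)) ⟩
    v ^ n + v + ((v * v) ^ n + v ^ n)   ≡⟨ solve 3 (λ x y z → x :+ y :+ (z :+ x) := z :+ y) refl (v ^ n) v _ ⟩
    (v * v) ^ n + v                     ≡⟨ cong (_+ v) (trans (^-distrib-* v v n) (sym (x^2n≡x^n*x^n v n))) ⟩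
    v ^ (2 ℕ.* n) + v                   ∎
    where n = 2 ℕ.^ suc j

  -- The argument equals ℘ (w + w̄), whose trace telescopes to the sum of w + w̄ and its conjugate;
  -- but w + w̄ is its own conjugate.
  trace-℘+bar : ∀ w → trace h (℘ w + bar (℘ w)) ≡ 0#
  trace-℘+bar w = begin
    trace h (℘ w + bar (℘ w))            ≡⟨ cong (λ z → trace h (℘ w + z))
        (trans (bar-+ (w * w) w) (cong (_+ bar w) (bar-* w w))) ⟩
    trace h (℘ w + ℘ (bar w))            ≡⟨ cong (trace h) (solve 2 (λ w w̄ → (w :* w :+ w) :+ (w̄ :* w̄ :+ w̄)
                                              := (w :+ w̄) :* (w :+ w̄) :+ (w :+ w̄)) refl w (bar w)) ⟩
    trace h (℘ (w + bar w))              ≡⟨ trace-℘ h (w + bar w) ⟩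
    bar (w + bar w) + (w + bar w)        ≡⟨ cong (_+ (w + bar w))
        (trans (bar-+ w (bar w)) (cong (bar w +_) (bar-bar w))) ⟩
    bar w + w + (w + bar w)              ≡⟨ solve 2 (λ w w̄ → w̄ :+ w :+ (w :+ w̄) := con false)
        refl w (bar w) ⟩
    0#                                   ∎

  -- trace j (y / z) with the denominator cleared.
  hom-trace : ℕ → A → A → A
  hom-trace zero    y z = y
  hom-trace (suc j) y z = y ^ (2 ℕ.^ suc j) + hom-trace j y z * z ^ (2 ℕ.^ j)

  hom-trace-* : ∀ j u z → hom-trace j (u * z) z ≡ z ^ (2 ℕ.^ j) * trace j u
  hom-trace-* zero    u z = solve 2 (λ u z → u :* z := z :^ 1 :* u) refl u z
  hom-trace-* (suc j) u z = begin
    (u * z) ^ (2 ℕ.* n) + hom-trace j (u * z) z * z ^ n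
      ≡⟨ cong₂ (λ s t → s + t * z ^ n) (^-distrib-* u z (2 ℕ.* n)) (hom-trace-* j u z) ⟩
    u ^ (2 ℕ.* n) * z ^ (2 ℕ.* n) + z ^ n * trace j u * z ^ n
      ≡⟨ cong (λ t → u ^ (2 ℕ.* n) * t + z ^ n * trace j u * z ^ n) (x^2n≡x^n*x^n z n) ⟩
    u ^ (2 ℕ.* n) * (z ^ n * z ^ n) + z ^ n * trace j u * z ^ n
      ≡⟨ solve 3 (λ s t v → s :* (t :* t) :+ t :* v :* t := t :* t :* (v :+ s)) refl _ (z ^ n) (trace j u) ⟩
    z ^ n * z ^ n * (trace j u + u ^ (2 ℕ.* n))
      ≡⟨ cong (_* (trace j u + u ^ (2 ℕ.* n))) (x^2n≡x^n*x^n z n) ⟨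
    z ^ (2 ℕ.* n) * (trace j u + u ^ (2 ℕ.* n))   ∎
    where n = 2 ℕ.^ j

  -- In the inductive step the power of `f` has degree 4 · 2 ^ j and dominates the other summand, of
  -- degree 3 · 2 ^ j. For j = h the resulting degree is q.
  poly-hom-trace : ∀ j {l m f g} → Poly 2 l f → Poly 1 m g →
                   Poly (2 ℕ.^ j ℕ.* 2) (l ^ (2 ℕ.^ j)) (λ x → hom-trace j (f x) (g x))
  poly-hom-trace zero {l} {f = f} F G = subst (λ l → Poly 2 l f) (sym (*-identityʳ l)) F
  poly-hom-trace (suc j) F G = poly-+< (poly-^ (2 ℕ.^ suc j) F)
    (subst (ℕ._< 2 ℕ.^ suc j ℕ.* 2) (ℕ.*-distribˡ-+ n 2 1)
      (subst (n ℕ.* 3 ℕ.<_) (trans (sym (ℕ.*-assoc n 2 2)) (cong (ℕ._* 2) (ℕ.*-comm n 2)))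
        (ℕ.*-monoʳ-< n (ℕ.n<1+n 3))))
    (poly-* (poly-hom-trace j F G) (poly-^ n G))
    where
    n = 2 ℕ.^ j
    instance _ = ℕ.m^n≢0 2 j

-- Conic points of prescribed norm.

module OvalNorms (𝔽 : Char2Field) (𝒪 : Ovals.Oval 𝔽) where

  open Char2Field 𝔽 using () renaming (Carrier to A)
  open Char2 𝔽
  open Norms 𝔽
  open ArtinSchreier 𝔽
  open Ovals.Oval 𝒪
  open Ovals.OvalProperties 𝔽 𝒪
  open ≡-Reasoning

  -- Otherwise `form` would vanish at (b, w).
  ℘≢ab : ∀ w → ℘ w ≢ a * b
  ℘≢ab w e = b≢0 (proj₁ (anisotropic {b} {w} (combine₁ b e
    (solve 3 (λ a b w → a :* (b :* b) :+ b :* w :+ b :* (w :* w) :+ con false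
       := b :* ((w :* w :+ w) :+ a :* b)) refl a b w))))

  -- On the circle ‖x‖ = ν the element z = 1 / (x + x₀)² satisfies z̄ = (1 + χ z) / (χ̄ + κ z); if no point
  -- of the conic lies on the circle, then b c z is in the image of ℘, and hence a polynomial of
  -- degree q vanishes at z.
  norm-avoiding : ∀ {ν} → ν ≢ norm x₀ → bar ν ≡ ν → (∀ p → Conic p → norm (proj₁ p) ≢ ν) →
                  AtMost q (λ x → norm x ≡ ν)
  norm-avoiding {ν} ν≢ ν̄≡ν avoid =
    atMost-image (λ {x} _ → z x) z-injective root (subst (λ d → AtMost d (λ t → f t ≡ 0#))
        (ℕ.*-comm (2 ℕ.^ h) 2)
      (roots (poly-hom-trace h poly-F poly-G) (x^n≢0 (2 ℕ.^ h) (x*y≢0 (x*y≢0 b≢0 c≢0) κ≢0))))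
    where
    g χ χ̄ κ : A
    g = b * c
    χ = x₀ * x₀
    χ̄ = bar x₀ * bar x₀
    κ = χ * χ̄ + ν * ν
    F G f z : A → A
    F t = g * κ * (t * t) + (g * χ̄ + bar g * χ) * t + bar g
    G t = κ * t + χ̄
    f t = hom-trace h (F t) (G t)
    z x = inv ((x + x₀) * (x + x₀))
    poly-F = poly-quadratic (g * κ) (g * χ̄ + bar g * χ) (bar g)
    poly-G = poly-linear κ χ̄
    κ≢0 : κ ≢ 0#
    κ≢0 e = ν≢ (x*x≡y*y⇒x≡y (combine₁ 1# e (solve 3 (λ x₀ x̄₀ ν → ν :* ν :+ x₀ :* x̄₀ :* (x₀ :* x̄₀)
      := con true :* (x₀ :* x₀ :* (x̄₀ :* x̄₀) :+ ν :* ν :+ con false)) refl x₀ (bar x₀) ν)))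
    module _ {x} (nx : norm x ≡ ν) where
      s = x + x₀
      s≢0 : s ≢ 0#
      s≢0 e = ν≢ (trans (sym nx) (cong norm (+≡0⇒≡ e)))
      zs²≡1 : s * s * z x ≡ 1#
      zs²≡1 = x*inv (x*y≢0 s≢0 s≢0)
      z̄s̄²≡1 : (bar x + bar x₀) * (bar x + bar x₀) * bar (z x) ≡ 1#
      z̄s̄²≡1 = begin
        (bar x + bar x₀) * (bar x + bar x₀) * bar (z x)   ≡⟨ cong (λ t → t * t * bar (z x)) (bar-+ x x₀) ⟨
        bar s * bar s * bar (z x)                         ≡⟨ trans (bar-* (s * s) (z x))
            (cong (_* bar (z x)) (bar-* s s)) ⟨
        bar (s * s * z x)                                 ≡⟨ trans (cong bar zs²≡1) bar-1 ⟩
        1#                                                ∎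
      -- Putting t = s w / b in a s² + s t + b t² = c and multiplying by b / s² gives ℘ w + a b = b
      -- c z; a solution w is thus a conic point of abscissa x.
      not-on-conic : ∀ w → ℘ w + a * b ≢ g * z x
      not-on-conic w e = avoid (x , y₀ + s * w * inv b)
        (combine₃ (s * s * inv b) c (a * (s * s) + s * s * (w * w) * inv b + c * (s * s) * z x) e zs²≡1
            (x*inv b≢0)
          (solve 8 (λ a b c b′ y₀ s w z →
             let t = (y₀ :+ s :* w :* b′) :+ y₀ in
             a :* (s :* s) :+ s :* t :+ b :* (t :* t) :+ c
             := s :* s :* b′ :* ((w :* w :+ w :+ a :* b) :+ b :* c :* z) :+ c :* (s :* s :* z :+ con true) :+
                (a :* (s :* s) :+ s :* s :* (w :* w) :* b′ :+ c :* (s :* s) :* z) :* (b :* b′ :+ con true))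
             refl a b c (inv b) y₀ s w (z x))) nx
      ζ : ∃[ w ] ℘ w ≡ g * z x
      ζ = ℘-index ℘≢ab (g * z x) not-on-conic
      -- From x² = χ + 1 / z and its conjugate, ν² = (χ + 1 / z)(χ̄ + 1 / z̄); clearing denominators
      -- gives this relation.
      mobius : bar (z x) * (κ * z x + χ̄) ≡ 1# + χ * z x
      mobius = combine₃ (1# + χ̄ * bar (z x)) (s * s * z x + χ * z x)
          (z x * bar (z x) * (x * bar x + ν)) zs²≡1 z̄s̄²≡1 nx
        (solve 7 (λ x x̄ x₀ x̄₀ z z̄ ν → let χ = x₀ :* x₀ ; χ̄ = x̄₀ :* x̄₀ ; κ = χ :* χ̄ :+ ν :* ν ; s² = (x :+ x₀) :* (x :+ x₀) in
           z̄ :* (κ :* z :+ χ̄) :+ (con true :+ χ :* z)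
           := (con true :+ χ̄ :* z̄) :* (s² :* z :+ con true) :+
              (s² :* z :+ χ :* z) :* ((x̄ :+ x̄₀) :* (x̄ :+ x̄₀) :* z̄ :+ con true) :+
              z :* z̄ :* (x :* x̄ :+ ν) :* (x :* x̄ :+ ν)) refl x (bar x) x₀ (bar x₀) (z x) (bar (z x)) ν)
      -- `F` / `G` is g z plus its conjugate, with `mobius` used to express z̄ by z.
      F≡uG : F (z x) ≡ (g * z x + bar (g * z x)) * G (z x)
      F≡uG = begin
        F (z x)  ≡⟨ combine₁ (bar g) (sym mobius) (solve 7 (λ g ḡ κ χ χ̄ z z̄ →
             g :* κ :* (z :* z) :+ (g :* χ̄ :+ ḡ :* χ) :* z :+ ḡ :+ (g :* z :+ ḡ :* z̄) :* (κ :* z :+ χ̄)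
             := ḡ :* ((con true :+ χ :* z) :+ z̄ :* (κ :* z :+ χ̄))) refl g (bar g) κ χ χ̄ (z x) (bar (z x))) ⟩
        (g * z x + bar g * bar (z x)) * G (z x)  ≡⟨ cong (λ t → (g * z x + t) * G (z x)) (bar-* g (z x)) ⟨
        (g * z x + bar (g * z x)) * G (z x)      ∎
      root : f (z x) ≡ 0#
      root = begin
        hom-trace h (F (z x)) (G (z x))                     ≡⟨ cong (λ t → hom-trace h t (G (z x))) F≡uG ⟩
        hom-trace h (u * G (z x)) (G (z x))                 ≡⟨ hom-trace-* h u (G (z x)) ⟩
        G (z x) ^ (2 ℕ.^ h) * trace h u                     ≡⟨ cong
            (λ t → G (z x) ^ (2 ℕ.^ h) * trace h (t + bar t)) (proj₂ ζ) ⟨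
        G (z x) ^ (2 ℕ.^ h) * trace h (℘ w + bar (℘ w))     ≡⟨ cong (G (z x) ^ (2 ℕ.^ h) *_) (trace-℘+bar w) ⟩
        G (z x) ^ (2 ℕ.^ h) * 0#                            ≡⟨ zeroʳ _ ⟩
        0#                                                  ∎
        where
        u = g * z x + bar (g * z x)
        w = proj₁ ζ
    z-injective : ∀ {x x′} → norm x ≡ ν → norm x′ ≡ ν → z x ≡ z x′ → x ≡ x′
    z-injective {x} {x′} nx nx′ e = +-cancelˡ x₀ _ _ (trans (+-comm x₀ x) (trans
      (x*x≡y*y⇒x≡y (*-cancelˡ z≢0 (trans (trans (*-comm (z x) _) (zs²≡1 nx))
          (sym (trans (trans (*-comm (z x) _) (cong (_ *_) e)) (zs²≡1 nx′))))))
      (+-comm x′ x₀)))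
      where
      z≢0 : z x ≢ 0#
      z≢0 = x*y≡1⇒x≢0 (trans (*-comm (z x) _) (zs²≡1 nx))

-- The choice of P.

module GoodPoints (𝔽 : Char2Field) (𝒪 : Ovals.Oval 𝔽) where

  open Char2Field 𝔽 using () renaming (Carrier to A)
  open Char2 𝔽
  open Norms 𝔽
  open Ovals.Oval 𝒪
  open Ovals.OvalProperties 𝔽 𝒪
  open OvalNorms 𝔽 𝒪
  open ≡-Reasoning

  r : A
  r = sqrt (c * inv b)

  br²≡c : b * (r * r) ≡ c
  br²≡c = begin
    b * (r * r)       ≡⟨ cong (b *_) (sqrt*sqrt (c * inv b)) ⟩
    b * (c * inv b)   ≡⟨ combine₁ c (x*inv b≢0) (solve 3
        (λ b c b′ → b :* (c :* b′) :+ c := c :* (b :* b′ :+ con true)) refl b c (inv b)) ⟩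
    c                 ∎

  -- On the vertical through the nucleus the equation of the conic reduces to b t² = c.
  partner : Conic (x₀ , y₀ + r)
  partner = combine₁ 1# br²≡c (solve 6 (λ a b c x₀ y₀ r → let s = x₀ :+ x₀ ; t = (y₀ :+ r) :+ y₀ in
    (a :* (s :* s) :+ s :* t :+ b :* (t :* t)) :+ c := con true :* (b :* (r :* r) :+ c)) refl a b c x₀ y₀ r)

  -- With the nucleus as one further candidate for R this gives the 7 of the count.
  Good : A → A → Set
  Good x y = (x≢0 : x ≢ 0#) → AtMost 6 (Transversal.Meets x y x≢0)

  good-γ : ∀ {x y} → (∀ x≢0 → Transversal.γ x y x≢0 ≢ 0#) → Good x y
  good-γ {x} {y} γ≢0 x≢0 = Transversal.meets-γ≢0 x y x≢0 (γ≢0 x≢0)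

  good-α : ∀ {x y} → (∀ x≢0 → Transversal.γ x y x≢0 ≡ 0# × Transversal.α x y x≢0 ≢ 0#) → Good x y
  good-α {x} {y} γα x≢0 = atMost-≤ (s≤s (s≤s (s≤s (s≤s z≤n))))
    (Transversal.meets-γ≡0 x y x≢0 (proj₁ (γα x≢0)) (proj₂ (γα x≢0)))

  -- A good point is obtained only in doubly negated form, `none` denying its existence; that
  -- suffices, as the count using it ends in `⊥`.
  module _ {ν} (ν≢0 : ν ≢ 0#) (ν̄≡ν : bar ν ≡ ν)
           (none : ∀ {x y} → Hyperoval (x , y) → norm x ≡ ν → ¬ Good x y) where

    private
      -- For a conic point with γ = 0, taking norms in b̄ x̄ = b x̄₀ gives norm x = norm x₀; so
      -- every conic point of norm ν is good.
      ν≢‖x₀‖⇒⊥ : ν ≢ norm x₀ → ⊥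
      ν≢‖x₀‖⇒⊥ ν≢ = norm-fibre-large ν≢0 ν̄≡ν (norm-avoiding ν≢ ν̄≡ν λ { (x , y) on nx →
        none (inj₂ on) nx (good-γ λ x≢0 γ≡0 → ν≢ (begin
          ν                 ≡⟨ nx ⟨
          norm x            ≡⟨ *-cancelˡ (norm≢0 b≢0) (begin
            norm b * norm x             ≡⟨ cong₂ _*_ (norm-bar b) (norm-bar x) ⟨
            norm (bar b) * norm (bar x) ≡⟨ norm-* (bar b) (bar x) ⟨
            norm (bar b * bar x)        ≡⟨ cong norm (Transversal.γ≡0⇒b̄x̄≡bx̄₀ x y x≢0 γ≡0) ⟩
            norm (b * bar x₀)           ≡⟨ trans (norm-* b (bar x₀)) (cong (norm b *_) (norm-bar x₀)) ⟩
            norm b * norm x₀            ∎) ⟩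
          norm x₀           ∎)) })

      module _ (ν≡ : ν ≡ norm x₀) where

        x₀≢0 : x₀ ≢ 0#
        x₀≢0 = norm≢0⇒≢0 (ν≢0 ∘ trans ν≡)

        -- If neither the nucleus nor the conic point on the same vertical is good, then b is fixed by
        -- bar, b (a + ā) = 1 and b c = x₀²; in that case (x₀ + x₀ / (a b) , y₀ + x₀ / b) is a good point.
        module _ (γ≡0 : Transversal.γ x₀ y₀ x₀≢0 ≡ 0#)
                 (α≡0 : Transversal.α x₀ y₀ x₀≢0 ≡ 0#)
                 (α′≡0 : Transversal.α x₀ (y₀ + r) x₀≢0 ≡ 0#) where

          b̄≡b : bar b ≡ b
          b̄≡b = *-cancelˡ (bar≢0 x₀≢0) (trans (*-comm _ _)
            (trans (Transversal.γ≡0⇒b̄x̄≡bx̄₀ x₀ y₀ x₀≢0 γ≡0) (*-comm _ _)))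

          -- With b̄ = b, α is b (a x̄₀² + k̄). Here k is a x₀² + c at the nucleus and a x₀² + x₀ r
          -- at `partner`, since b r² = c there.
          α≡0⇒ : ∀ {k} → bar b * (bar x₀ * bar x₀) * a + b * bar k ≡ 0# → k ≡ bar a * (x₀ * x₀)
          α≡0⇒ {k} e = bar-injective (begin
            bar k                         ≡⟨ *-cancelˡ b≢0 (combine₂ 1# (bar x₀ * bar x₀ * a) e b̄≡b
              (solve 5 (λ a b b̄ x̄₀ k̄ → b :* k̄ :+ b :* (a :* (x̄₀ :* x̄₀))
                := con true :* (b̄ :* (x̄₀ :* x̄₀) :* a :+ b :* k̄ :+ con false)
                    :+ x̄₀ :* x̄₀ :* a :* (b̄ :+ b))
                refl a b (bar b) (bar x₀) (bar k))) ⟩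
            a * (bar x₀ * bar x₀)         ≡⟨ cong₂ _*_ (bar-bar a) (bar-* x₀ x₀) ⟨
            bar (bar a) * bar (x₀ * x₀)   ≡⟨ bar-* (bar a) (x₀ * x₀) ⟨
            bar (bar a * (x₀ * x₀))       ∎)

          c≡ : c ≡ (a + bar a) * (x₀ * x₀)
          c≡ = combine₁ 1# (α≡0⇒ α≡0) (solve 6 (λ a ā b c x₀ y₀ → let t = y₀ :+ y₀ in
            c :+ (a :+ ā) :* (x₀ :* x₀)
            := con true :* (a :* (x₀ :* x₀) :+ x₀ :* t :+ b :* (t :* t) :+ c :+ ā :* (x₀ :* x₀)))
                refl a (bar a) b c x₀ y₀)

          r≡ : r ≡ (a + bar a) * x₀
          r≡ = *-cancelˡ x₀≢0 (combine₂ 1# 1# (α≡0⇒ α′≡0) br²≡c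
              (solve 7 (λ a ā b c x₀ y₀ r → let t = (y₀ :+ r) :+ y₀ in
            x₀ :* r :+ x₀ :* ((a :+ ā) :* x₀)
            := con true :* (a :* (x₀ :* x₀) :+ x₀ :* t :+ b :* (t :* t) :+ c :+ ā :* (x₀ :* x₀))
                :+ con true :* (b :* (r :* r) :+ c))
            refl a (bar a) b c x₀ y₀ r))

          b[a+ā]≡1 : b * (a + bar a) ≡ 1#
          b[a+ā]≡1 = *-cancelˡ c≢0 (begin
            c * (b * (a + bar a))                          ≡⟨ cong (_* (b * (a + bar a))) c≡ ⟩
            (a + bar a) * (x₀ * x₀) * (b * (a + bar a))    ≡⟨ solve 3
                (λ b e x → e :* (x :* x) :* (b :* e) := b :* (e :* x :* (e :* x))) refl b (a + bar a) x₀ ⟩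
            b * ((a + bar a) * x₀ * ((a + bar a) * x₀))    ≡⟨ cong (λ t → b * (t * t)) r≡ ⟨
            b * (r * r)                                    ≡⟨ br²≡c ⟩
            c                                              ≡⟨ *-identityʳ c ⟨
            c * 1#                                         ∎)

          cb≡x₀² : c * b ≡ x₀ * x₀
          cb≡x₀² = combine₂ b (x₀ * x₀) c≡ b[a+ā]≡1 (solve 4 (λ b c e x → c :* b :+ x :* x
            := b :* (c :+ e :* (x :* x)) :+ x :* x :* (b :* e :+ con true)) refl b c (a + bar a) x₀)

          m m̄ x₁ y₁ : A
          m  = inv (a * b)
          m̄  = bar m
          -- The second conic point on the horizontal line through `partner`: t = r = x₀ / b, so
          -- that b t² = c, and a s² + s t = 0 leaves s = t / a.
          x₁ = x₀ + x₀ * m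
          y₁ = y₀ + x₀ * inv b

          abm≡1 : a * b * m ≡ 1#
          abm≡1 = x*inv (x*y≢0 a≢0 b≢0)

          ābm̄≡1 : bar a * b * m̄ ≡ 1#
          ābm̄≡1 = begin
            bar a * b * m̄        ≡⟨ cong (λ t → bar a * t * m̄) b̄≡b ⟨
            bar a * bar b * m̄    ≡⟨ trans (bar-* (a * b) m) (cong (_* m̄) (bar-* a b)) ⟨
            bar (a * b * m)      ≡⟨ trans (cong bar abm≡1) bar-1 ⟩
            1#                   ∎

          on : Conic (x₁ , y₁)
          on = combine₃ (m * (x₀ * x₀) * inv b) (m * (x₀ * x₀) * (a * m) + inv b * (x₀ * x₀) + c)
              (inv b) abm≡1 (x*inv b≢0) cb≡x₀²
            (solve 7 (λ a b c x₀ y₀ m b′ → let s = (x₀ :+ x₀ :* m) :+ x₀ ; t = (y₀ :+ x₀ :* b′) :+ y₀ ; x² = x₀ :* x₀ in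
              (a :* (s :* s) :+ s :* t :+ b :* (t :* t)) :+ c
              := m :* x² :* b′ :* (a :* b :* m :+ con true)
                  :+ (m :* x² :* (a :* m) :+ b′ :* x² :+ c) :* (b :* b′ :+ con true) :+
                 b′ :* (c :* b :+ x²)) refl a b c x₀ y₀ m (inv b))

          nx₁≡ν : norm x₁ ≡ ν
          nx₁≡ν = begin
            norm (x₀ + x₀ * m)           ≡⟨ cong norm (solve 2
                (λ x m → x :+ x :* m := x :* (con true :+ m)) refl x₀ m) ⟩
            norm (x₀ * (1# + m))         ≡⟨ norm-* x₀ (1# + m) ⟩
            norm x₀ * norm (1# + m)      ≡⟨ cong (norm x₀ *_) (begin
              (1# + m) * bar (1# + m)         ≡⟨ cong ((1# + m) *_) (trans (bar-+ 1# m) (cong (_+ m̄) bar-1)) ⟩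
              -- m + m̄ = (a + ā) / (a ā b) cancels m m̄ = 1 / (a ā b²), because b (a + ā) = 1.
              (1# + m) * (1# + m̄)             ≡⟨ combine₃ (m * m̄) m̄ m b[a+ā]≡1 abm≡1 ābm̄≡1
                (solve 5 (λ a ā b m m̄ → (con true :+ m) :* (con true :+ m̄) :+ con true
                  := m :* m̄ :* (b :* (a :+ ā) :+ con true) :+ m̄ :* (a :* b :* m :+ con true)
                      :+ m :* (ā :* b :* m̄ :+ con true))
                  refl a (bar a) b m m̄) ⟩
              1#                              ∎) ⟩
            norm x₀ * 1#                 ≡⟨ trans (*-identityʳ _) (sym ν≡) ⟩
            ν                            ∎

          third⇒⊥ : ⊥
          -- Here γ = 0 would force x₁ = x₀, although `m` is nonzero.
          third⇒⊥ = none (inj₂ on) nx₁≡ν (good-γ λ x₁≢0 γ≡0 →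
            x*y≢0 x₀≢0 (x*y≡1⇒x≢0 (trans (*-comm m (a * b)) abm≡1))
              (combine₁ 1# (bar-injective (*-cancelˡ b≢0
                 (trans (cong (_* bar x₁) (sym b̄≡b)) (Transversal.γ≡0⇒b̄x̄≡bx̄₀ x₁ y₁ x₁≢0 γ≡0))))
                (solve 2 (λ x t → t :+ con false := con true :* ((x :+ t) :+ x)) refl x₀ (x₀ * m))))

        ν≡‖x₀‖⇒⊥ : ⊥
        ν≡‖x₀‖⇒⊥ with Transversal.γ x₀ y₀ x₀≢0 ≟ 0#
        ... | no γ≢0 = none (inj₁ refl) (sym ν≡) (good-γ λ _ → γ≢0)
        ... | yes γ≡0 with Transversal.α x₀ y₀ x₀≢0 ≟ 0#
        ... | no α≢0 = none (inj₁ refl) (sym ν≡) (good-α λ _ → γ≡0 , α≢0)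
        ... | yes α≡0 with Transversal.α x₀ (y₀ + r) x₀≢0 ≟ 0#
        -- `γ` does not involve the ordinate of the point, so `γ≡0` holds for `partner` too.
        ... | no α′≢0 = none (inj₂ partner) (sym ν≡) (good-α λ _ → γ≡0 , α′≢0)
        ... | yes α′≡0 = third⇒⊥ γ≡0 α≡0 α′≡0

    ¬¬good-point : ⊥
    ¬¬good-point with ν ≟ norm x₀
    ... | yes ν≡ = ν≡‖x₀‖⇒⊥ ν≡
    ... | no ν≢  = ν≢‖x₀‖⇒⊥ ν≢

-- Chords of the regular hyperoval in the affine plane.

module Chords (𝔽 : Char2Field) (𝒪 : Ovals.Oval 𝔽) where

  open Char2Field 𝔽 using () renaming (Carrier to A)
  open Char2 𝔽
  open Ovals.Oval 𝒪
  open Ovals.OvalProperties 𝔽 𝒪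
  open GoodPoints 𝔽 𝒪
  open ≡-Reasoning

  _≟ₚ_ : DecidableEquality (A × A)
  _≟ₚ_ = ≡-dec _≟_ _≟_

  hyperoval? : Decidable Hyperoval
  hyperoval? p@(x , y) = (p ≟ₚ (x₀ , y₀)) ⊎-dec (form (x + x₀) (y + y₀) ≟ c)

  nucleus-off-conic : ¬ Conic (x₀ , y₀)
  nucleus-off-conic on = c≢0 (combine₁ 1# on (solve 5 (λ a b c x y → c :+ con false
    := con true :* ((a :* ((x :+ x) :* (x :+ x)) :+ (x :+ x) :* (y :+ y) :+ b :* ((y :+ y) :* (y :+ y)))
        :+ c)) refl a b c x₀ y₀))

  φ : A → A
  φ m = form 1# m

  φ≢0 : ∀ m → φ m ≢ 0#
  φ≢0 m e = 1≢0 (proj₁ (anisotropic e))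

  ρ : A → A
  ρ m = sqrt (c * inv (φ m))

  ρρφ≡c : ∀ m → ρ m * ρ m * φ m ≡ c
  ρρφ≡c m = begin
    ρ m * ρ m * φ m         ≡⟨ cong (_* φ m) (sqrt*sqrt (c * inv (φ m))) ⟩
    c * inv (φ m) * φ m     ≡⟨ combine₁ c (x*inv (φ≢0 m))
        (solve 3 (λ c f g → c :* g :* f :+ c := c :* (f :* g :+ con true)) refl c (φ m) (inv (φ m))) ⟩
    c                       ∎

  ρ≢0 : ∀ m → ρ m ≢ 0#
  ρ≢0 m e = c≢0 (trans (sym (ρρφ≡c m)) (trans (cong (λ t → t * ρ m * φ m) e)
      (trans (cong (_* φ m) (zeroˡ _)) (zeroˡ _))))

  nucleus-chord : ∀ {r} m → form (x₀ + r + x₀) (y₀ + m * r + y₀) ≡ r * r * φ m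
  nucleus-chord {r} m = solve 6 (λ a b x₀ y₀ m r → let s = x₀ :+ r :+ x₀ ; t = y₀ :+ m :* r :+ y₀ in
    a :* (s :* s) :+ s :* t :+ b :* (t :* t) := r :* r :*
        (a :* (con true :* con true) :+ con true :* m :+ b :* (m :* m)))
    refl a b x₀ y₀ m r

  from-nucleus : A → A × A
  from-nucleus m = x₀ + ρ m , y₀ + m * ρ m

  from-nucleus-on : ∀ m → Conic (from-nucleus m)
  from-nucleus-on m = trans (nucleus-chord m) (ρρφ≡c m)

  -- The difference of the two conic equations is r times a factor linear in r, so a line through a
  -- conic point has at most one further conic point.
  conic-chord : ∀ {x y r} m → Conic (x , y) → Conic (x + r , y + m * r) →
                r * (r * φ m + ((x + x₀) * m + (y + y₀))) ≡ 0#
  conic-chord {x} {y} {r} m on on′ = combine₂ 1# 1# on on′ (solve 9 (λ a b c x₀ y₀ x y m r →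
    let s = x :+ x₀ ; t = y :+ y₀ ; s′ = x :+ r :+ x₀ ; t′ = y :+ m :* r :+ y₀ in
    r :* (r :* (a :* (con true :* con true) :+ con true :* m :+ b :* (m :* m)) :+ (s :* m :+ t)) :+ con false
    := con true :* (a :* (s :* s) :+ s :* t :+ b :* (t :* t) :+ c)
        :+ con true :* (a :* (s′ :* s′) :+ s′ :* t′ :+ b :* (t′ :* t′) :+ c))
    refl a b c x₀ y₀ x y m r)

  conic-chord⁻ : ∀ {x y r} m → Conic (x , y) → r * φ m ≡ (x + x₀) * m + (y + y₀) → Conic (x + r , y + m * r)
  conic-chord⁻ {x} {y} {r} m on e = combine₂ 1# r on e (solve 9 (λ a b c x₀ y₀ x y m r →
    let s = x :+ x₀ ; t = y :+ y₀ ; s′ = x :+ r :+ x₀ ; t′ = y :+ m :* r :+ y₀ in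
    a :* (s′ :* s′) :+ s′ :* t′ :+ b :* (t′ :* t′) :+ c
    := con true :* (a :* (s :* s) :+ s :* t :+ b :* (t :* t) :+ c) :+
       r :* (r :* (a :* (con true :* con true) :+ con true :* m :+ b :* (m :* m)) :+ (s :* m :+ t)))
    refl a b c x₀ y₀ x y m r)

  Collinear : A → A × A → A × A → Set
  Collinear m (x , y) (x′ , y′) = y′ + m * x′ ≡ y + m * x

  shift : ∀ {m x y x′ y′} → Collinear m (x , y) (x′ , y′) → (x′ , y′) ≡ (x + (x′ + x) , y + m * (x′ + x))
  shift {m} {x} {y} {x′} {y′} col = cong₂ _,_ (solve 2 (λ x x′ → x′ := x :+ (x′ :+ x)) refl x x′)
    (combine₁ 1# col (solve 5 (λ m x y x′ y′ → y′ :+ (y :+ m :* (x′ :+ x))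
      := con true :* ((y′ :+ m :* x′) :+ (y :+ m :* x))) refl m x y x′ y′))

  shift≢0 : ∀ {m p p′} → Collinear m p p′ → p′ ≢ p → proj₁ p′ + proj₁ p ≢ 0#
  shift≢0 {m} {x , y} {x′ , y′} col p′≢p e = p′≢p (trans (shift col) (trans (cong (λ r → x + r , y + m * r) e)
    (cong₂ _,_ (+-identityʳ x) (trans (cong (y +_) (zeroʳ m)) (+-identityʳ y)))))

  chord : ∀ p m → Hyperoval p → ∃[ p′ ] (p′ ≢ p × Hyperoval p′ × Collinear m p p′)
  chord .(x₀ , y₀) m (inj₁ refl) = from-nucleus m ,
      (λ e → nucleus-off-conic (subst Conic e (from-nucleus-on m))) ,
    inj₂ (from-nucleus-on m) , solve 4 (λ x y m r → y :+ m :* r :+ m :* (x :+ r) := y :+ m :* x)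
        refl x₀ y₀ m (ρ m)
  chord (x , y) m (inj₂ on) with ((x + x₀) * m + (y + y₀)) ≟ 0#
  -- The line is then tangent to the conic and passes through the nucleus.
  ... | yes ψ≡0 = (x₀ , y₀) , (λ { refl → nucleus-off-conic on }) , inj₁ refl ,
    combine₁ 1# ψ≡0 (solve 5 (λ x₀ y₀ x y m → (y₀ :+ m :* x₀) :+ (y :+ m :* x)
      := con true :* ((x :+ x₀) :* m :+ (y :+ y₀) :+ con false)) refl x₀ y₀ x y m)
  ... | no ψ≢0 = (x + d , y + m * d) ,
    (λ e → x*y≢0 ψ≢0 (x*y≡1⇒x≢0 (trans (*-comm _ (φ m)) (x*inv (φ≢0 m))))
        (+-cancelˡ x d 0# (trans (cong proj₁ e) (sym (+-identityʳ x))))) ,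
    inj₂ (conic-chord⁻ m on (combine₁ ψ (x*inv (φ≢0 m))
        (solve 3 (λ p f g → p :* g :* f :+ p := p :* (f :* g :+ con true)) refl ψ (φ m) (inv (φ m))))) ,
    solve 4 (λ x y m r → y :+ m :* r :+ m :* (x :+ r) := y :+ m :* x) refl x y m d
    where
    ψ = (x + x₀) * m + (y + y₀)
    d = ψ * inv (φ m)

  chord-end : ∀ {x y p′} m → Conic (x , y) → p′ ≢ (x , y) → Hyperoval p′ → Collinear m (x , y) p′ →
              (p′ ≡ (x₀ , y₀) × (x + x₀) * m + (y + y₀) ≡ 0#) ⊎ ((proj₁ p′ + x) * φ m ≡ (x + x₀) * m + (y + y₀))
  chord-end {x} {y} m on _ (inj₁ refl) col = inj₁ (refl , combine₁ 1# col
    (solve 5 (λ x₀ y₀ x y m → ((x :+ x₀) :* m :+ (y :+ y₀)) :+ con false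
      := con true :* ((y₀ :+ m :* x₀) :+ (y :+ m :* x))) refl x₀ y₀ x y m))
  chord-end m on p′≢p (inj₂ on′) col = inj₂ (+≡0⇒≡ (x*y≡0⇒y≡0 (shift≢0 col p′≢p)
    (conic-chord m on (subst Conic (shift col) on′))))

  same-shift : ∀ {m p p′ p″} → Collinear m p p′ → Collinear m p p″ → proj₁ p′ + proj₁ p
      ≡ proj₁ p″ + proj₁ p → p′ ≡ p″
  same-shift {m} {x , y} c′ c″ e = trans (shift c′) (trans (cong (λ r → x + r , y + m * r) e) (sym (shift c″)))

  chord-unique : ∀ {p m p′ p″} → Hyperoval p → p′ ≢ p → Hyperoval p′ → Collinear m p p′ →
                 p″ ≢ p → Hyperoval p″ → Collinear m p p″ → p′ ≡ p″
  chord-unique (inj₁ refl) ≢′ (inj₁ e) c′ _ _ _ = contradiction e ≢′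
  chord-unique (inj₁ refl) _ _ _ ≢″ (inj₁ e) _ = contradiction e ≢″
  chord-unique {m = m} (inj₁ refl) ≢′ (inj₂ h′) c′ ≢″ (inj₂ h″) c″ = same-shift c′ c″
    (x*x≡y*y⇒x≡y (*-cancelˡ (φ≢0 m) (trans (*-comm (φ m) _)
        (trans (trans (end c′ h′) (sym (end c″ h″))) (*-comm _ (φ m))))))
    where
    end : ∀ {p} → Collinear m (x₀ , y₀) p → Conic p → (proj₁ p + x₀) * (proj₁ p + x₀) * φ m ≡ c
    end col on = trans (sym (nucleus-chord m)) (subst Conic (shift col) on)
  chord-unique {x , y} {m} (inj₂ on) ≢′ h′ c′ ≢″ h″ c″
    with chord-end m on ≢′ h′ c′ | chord-end m on ≢″ h″ c″
  ... | inj₁ (refl , _) | inj₁ (refl , _) = refl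
  ... | inj₂ e′ | inj₂ e″ = same-shift c′ c″ (*-cancelˡ (φ≢0 m)
      (trans (*-comm (φ m) _) (trans (trans e′ (sym e″)) (*-comm _ (φ m)))))
  ... | inj₁ (_ , ψ≡0) | inj₂ e″ = contradiction (trans e″ ψ≡0) (x*y≢0 (shift≢0 c″ ≢″) (φ≢0 m))
  ... | inj₂ e′ | inj₁ (_ , ψ≡0) = contradiction (trans e′ ψ≡0) (x*y≢0 (shift≢0 c′ ≢′) (φ≢0 m))

  -- The nucleus, one conic point on each of the q² lines of finite slope through it, and `partner`
  -- on the vertical are q² + 2 points.
  hyperoval-large : ¬ AtMost (suc (q ℕ.* q)) Hyperoval
  hyperoval-large few = ℕ.<⇒≱ (ℕ.n<1+n (suc (q ℕ.* q))) (subst (ℕ._≤ suc (q ℕ.* q))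
    (cong (λ n → suc (suc n)) (trans (length-map from-nucleus elements) size≡q*q))
    (few {(x₀ , y₀) ∷ (x₀ , y₀ + r) ∷ map from-nucleus elements}
      (((λ e → nucleus-off-conic (subst Conic (sym e) partner)) ∷
         All.map⁺ (All.universal (λ m e → nucleus-off-conic (subst Conic (sym e) (from-nucleus-on m)))
             elements)) ∷
       All.map⁺ (All.universal (λ m e → ρ≢0 m (sym (+-cancelˡ x₀ 0# (ρ m)
           (trans (+-identityʳ x₀) (cong proj₁ e))))) elements) ∷
       Unique.map⁺ inj unique)
      (inj₁ refl ∷ inj₂ partner ∷ All.map⁺ (All.universal (λ m → inj₂ (from-nucleus-on m)) elements))))
    where
    open Finite finite
    inj : ∀ {m m′} → from-nucleus m ≡ from-nucleus m′ → m ≡ m′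
    inj {m} {m′} e = *-cancelˡ (ρ≢0 m) (trans (*-comm (ρ m) m) (trans
      (+-cancelˡ y₀ _ _ (cong proj₂ e)) (trans (cong (m′ *_) (sym (+-cancelˡ x₀ _ _ (cong proj₁ e))))
          (*-comm m′ (ρ m)))))

-- Moulton lines and the count of slopes.

module MoultonArcs (𝔽 : Char2Field) (𝒪 : Ovals.Oval 𝔽)
  {u : Level} {U : Char2Field.Carrier 𝔽 → Set u} (U? : Decidable U)
  (U⇒≢0 : ∀ {ν} → U ν → ν ≢ Char2Field.0# 𝔽) (U⇒fixed : ∀ {ν} → U ν → Char2.bar 𝔽 ν ≡ ν) where

  open Char2Field 𝔽 using () renaming (Carrier to A)
  open Char2 𝔽
  open Ovals.Oval 𝒪
  open Norms 𝔽
  open Ovals.OvalProperties 𝔽 𝒪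
  open GoodPoints 𝔽 𝒪
  open Chords 𝔽 𝒪
  open ≡-Reasoning

  infixl 7 _⊙_
  _⊙_ : A → A → A
  m ⊙ x = if does (U? (norm x)) then bar m * x else m * x

  ⊙-inside : ∀ m {x} → U (norm x) → m ⊙ x ≡ bar m * x
  ⊙-inside m {x} ux rewrite dec-true (U? (norm x)) ux = refl

  ⊙-outside : ∀ m {x} → ¬ U (norm x) → m ⊙ x ≡ m * x
  ⊙-outside m {x} ¬ux rewrite dec-false (U? (norm x)) ¬ux = refl

  On : A → A → A × A → Set
  On m n (x , y) = y ≡ m ⊙ x + n

  NoThreeOnLine NoThreeOnVertical : Set
  NoThreeOnLine = ∀ {m n p p′ p″} → p ≢ p′ → p ≢ p″ → p′ ≢ p″ → Hyperoval p → Hyperoval p′ → Hyperoval p″ →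
                  On m n p → On m n p′ → On m n p″ → ⊥
  NoThreeOnVertical = ∀ {x y y′ y″} → y ≢ y′ → y ≢ y″ → y′ ≢ y″ →
                      Hyperoval (x , y) → Hyperoval (x , y′) → Hyperoval (x , y″) → ⊥

  module _ (noLine : NoThreeOnLine) (noVertical : NoThreeOnVertical) where

    vertical : ∀ x → AtMost 2 (λ p → proj₁ p ≡ x × Hyperoval p)
    vertical x = atMost-2 {P = λ p → proj₁ p ≡ x × Hyperoval p} λ where
      p≢ p≢′ p≢″ (refl , h) (refl , h′) (refl , h″) → noVertical (p≢ ∘ cong (x ,_)) (p≢′ ∘ cong (x ,_))
          (p≢″ ∘ cong (x ,_)) h h′ h″

    -- If the norm of x′ is in `U`, then m̄ x′ + m x = d and its conjugate are linear equations for
    -- m and m̄. Their determinant norm x + norm x′ is nonzero, as only one of the norms is in `U`;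
    -- `m₂` is Cramer's formula, and `m̄₂≡` checks that the second unknown is its conjugate.
    join : ∀ {x y x′ y′} → ¬ U (norm x) → x′ ≢ x → ∃[ m ] On m (y + m * x) (x′ , y′)
    join {x} {y} {x′} {y′} ¬ux x′≢x = case U? (norm x′) of λ where
        (no ¬ux′) → m₁ , (begin
          y′                        ≡⟨ combine₁ (y′ + y) (x*inv (x′≢x ∘ +≡0⇒≡))
              (solve 5 (λ x y x′ y′ i → let m = (y′ :+ y) :* i in
                                         y′ :+ (m :* x′ :+ (y :+ m :* x))
                                             := (y′ :+ y) :* ((x′ :+ x) :* i :+ con true))
                                             refl x y x′ y′ (inv (x′ + x))) ⟩
          m₁ * x′ + (y + m₁ * x)    ≡⟨ cong (_+ (y + m₁ * x)) (⊙-outside m₁ ¬ux′) ⟨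
          m₁ ⊙ x′ + (y + m₁ * x)    ∎)
        (yes ux′) → m₂ , (begin
          y′                                          ≡⟨ combine₁ (y′ + y) (ei≡1 ux′)
              (solve 8 (λ x x̄ x′ x̄′ y y′ d̄ i → let d = y′ :+ y in
             y′ :+ ((d̄ :* x :+ d :* x̄′) :* i :* x′ :+ (y :+ (d :* x̄ :+ d̄ :* x′) :* i :* x))
             := d :* ((x :* x̄ :+ x′ :* x̄′) :* i :+ con true)) refl x (bar x) x′ (bar x′) y y′ (bar d) i) ⟩
          (bar d * x + d * bar x′) * i * x′ + (y + m₂ * x)  ≡⟨ cong (λ t → t * x′ + (y + m₂ * x)) (m̄₂≡ ux′) ⟨
          bar m₂ * x′ + (y + m₂ * x)                  ≡⟨ cong (_+ (y + m₂ * x)) (⊙-inside m₂ ux′) ⟨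
          m₂ ⊙ x′ + (y + m₂ * x)                      ∎)
      where
      d e i m₁ m₂ : A
      d = y′ + y
      e = norm x + norm x′
      i = inv e
      m₁ = (y′ + y) * inv (x′ + x)
      m₂ = (d * bar x + bar d * x′) * i
      e≢0 : U (norm x′) → e ≢ 0#
      e≢0 ux′ e≡0 = ¬ux (subst U (sym (+≡0⇒≡ e≡0)) ux′)
      ei≡1 : U (norm x′) → e * i ≡ 1#
      ei≡1 ux′ = x*inv (e≢0 ux′)
      ī≡i : U (norm x′) → bar i ≡ i
      ī≡i ux′ = *-cancelˡ (e≢0 ux′) (begin
        e * bar i          ≡⟨ cong (_* bar i) (trans (bar-+ (norm x) (norm x′))
            (cong₂ _+_ (bar-norm x) (bar-norm x′))) ⟨
        bar e * bar i      ≡⟨ bar-* e i ⟨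
        bar (e * i)        ≡⟨ trans (cong bar (ei≡1 ux′)) bar-1 ⟩
        1#                 ≡⟨ ei≡1 ux′ ⟨
        e * i              ∎)
      m̄₂≡ : U (norm x′) → bar m₂ ≡ (bar d * x + d * bar x′) * i
      m̄₂≡ ux′ = begin
        bar m₂                                              ≡⟨ bar-* (d * bar x + bar d * x′) i ⟩
        bar (d * bar x + bar d * x′) * bar i                ≡⟨ cong₂ _*_
            (trans (bar-+ (d * bar x) (bar d * x′)) (cong₂ _+_ (bar-* d (bar x)) (bar-* (bar d) x′)))
            (ī≡i ux′) ⟩
        (bar d * bar (bar x) + bar (bar d) * bar x′) * i    ≡⟨ cong₂
            (λ s t → (bar d * s + t * bar x′) * i) (bar-bar x) (bar-bar d) ⟩
        (bar d * x + d * bar x′) * i                        ∎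

    -- Otherwise the directions of the lines through p would not suffice for the other points.
    hit : ∀ {x y} m → Hyperoval (x , y) → ¬ U (norm x) →
          ∃[ p′ ] (p′ ≢ (x , y) × Hyperoval p′ × On m (y + m * x) p′)
    hit {x} {y} m on ¬ux = case any? (λ p′ → ¬? (p′ ≟ₚ p) ×-dec hyperoval? p′ ×-dec
        (proj₂ p′ ≟ (m ⊙ proj₁ p′ + (y + m * x)))) of λ where
        (yes found) → found
        (no none)   → ⊥-elim (hyperoval-large (atMost-≤ bound
            (atMost-⊎ on-p (atMost-⊎ on-vertical on-line id) (classify none))))
      where
      open Finite (finite-× finite finite) using (any?)
      p = x , y
      OnP OnVertical OnLine : A × A → Set
      OnP p′        = p′ ≡ p
      OnVertical p′ = p′ ≢ p × Hyperoval p′ × proj₁ p′ ≡ x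
      OnLine p′     = ∃[ m′ ] (m′ ≢ m × p′ ≢ p × Hyperoval p′ × On m′ (y + m′ * x) p′)
      on-p : AtMost 1 OnP
      on-p = atMost-1 {P = OnP} λ { refl refl → refl }
      on-vertical : AtMost 1 OnVertical
      on-vertical = atMost-1 {P = OnVertical} λ { {_ , y′} {_ , y″} (≢′ , h′ , refl) (≢″ , h″ , refl)
          → case y′ ≟ y″ of λ where
        (yes e) → cong (x ,_) e
        (no ne) → contradiction h″ (noVertical (≢′ ∘ sym ∘ cong (x ,_)) (≢″ ∘ sym ∘ cong (x ,_)) ne on h′) }
      on-line : AtMost (ℕ.pred (q ℕ.* q) ℕ.* 1) OnLine
      on-line = Finite.atMost-fibres finite {P = _≢ m} (λ m′ → ¬? (m′ ≟ m))
        (λ u all → ℕ.<⇒≤pred (ℕ.≤-trans (Finite.atMost-size finite {P = λ _ → ⊤}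
            (All.map (_∘ sym) all ∷ u) (All.universal _ _)) (ℕ.≤-reflexive size≡q*q)))
        (λ {m′} _ → atMost-1 {P = λ p′ → p′ ≢ p × Hyperoval p′ × On m′ (y + m′ * x) p′}
          λ { {p′} {p″} (≢′ , h′ , on′) (≢″ , h″ , on″) → case p′ ≟ₚ p″ of λ where
            (yes e) → e
            (no ne) → contradiction on″ (noLine (≢′ ∘ sym) (≢″ ∘ sym) ne on h′ h″ (p-on m′) on′) })
        (λ { (m′ , ≢m , rest) → m′ , ≢m , rest })
        where
        p-on : ∀ m′ → On m′ (y + m′ * x) p
        p-on m′ = trans (solve 3 (λ m x y → y := m :* x :+ (y :+ m :* x)) refl m′ x y)
            (cong (_+ (y + m′ * x)) (sym (⊙-outside m′ ¬ux)))
      classify : ¬ (∃[ p′ ] (p′ ≢ p × Hyperoval p′ × On m (y + m * x) p′)) → ∀ {p′} → Hyperoval p′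
          → OnP p′ ⊎ (OnVertical p′ ⊎ OnLine p′)
      classify none {p′@(x′ , y′)} h′ with p′ ≟ₚ p | x′ ≟ x
      ... | yes e | _    = inj₁ e
      ... | no ≢p | yes e = inj₂ (inj₁ (≢p , h′ , e))
      ... | no ≢p | no x′≢x with m′ , on′ ← join {y = y} {y′ = y′} ¬ux x′≢x =
        inj₂ (inj₂ (m′ , (λ { refl → none (p′ , ≢p , h′ , on′) }) , ≢p , h′ , on′))
      -- The point p, at most one point on its vertical, and one for each of the q² - 1 slopes other
      -- than m.
      bound : 1 ℕ.+ (1 ℕ.+ ℕ.pred (q ℕ.* q) ℕ.* 1) ℕ.≤ suc (q ℕ.* q)
      bound = s≤s (ℕ.≤-trans (ℕ.≤-reflexive (cong suc (ℕ.*-identityʳ _)))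
          (ℕ.≤-reflexive (ℕ.suc-pred (q ℕ.* q))))
        where instance
          _ = ℕ.m^n≢0 2 (suc h)
          _ = ℕ.m*n≢0 q q

    Inside : A × A → Set u
    Inside p = Hyperoval p × U (norm (proj₁ p))

    circle-few : ∀ ν → AtMost (suc q ℕ.* 2) (λ p → norm (proj₁ p) ≡ ν × Hyperoval p)
    circle-few ν = Finite.atMost-fibres finite (λ x → norm x ≟ ν) (norm-fibre ν)
      (λ {x} _ → vertical x) (λ (e , on) → _ , e , refl , on)

    inside-few : ∀ {n} → AtMost n U → AtMost (n ℕ.* (suc q ℕ.* 2)) Inside
    inside-few few = Finite.atMost-fibres finite U? few (λ {ν} _ → circle-few ν)
      (λ (on , up) → _ , up , refl , on)

    module _ {x y : A} (on : Hyperoval (x , y)) (ux : U (norm x)) (few : Good x y) where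

      private
        p = x , y
        x≢0 : x ≢ 0#
        x≢0 = norm≢0⇒≢0 (U⇒≢0 ux)

      -- With p as the point P of the argument at the top, First p′ m says that p′ can be Q for the
      -- slope m, and Second p′ m that it can be R.
      First : A × A → A → Set
      First p′ m = p′ ≢ p × Collinear m p p′

      Second : A × A → A → Set
      Second (x′ , y′) m = y′ ≡ bar m * x′ + (y + m * x)

      first-unique : ∀ p′ → AtMost 1 (First p′)
      first-unique (x′ , y′) = atMost-1 {P = First (x′ , y′)} λ {m} {m′} (p′≢p , e) (_ , e′) →
        *-cancelˡ (shift≢0 e p′≢p) (combine₂ 1# 1# e e′
            (solve 6 (λ x y x′ y′ m m′ → (x′ :+ x) :* m :+ (x′ :+ x) :* m′
          := con true :* ((y′ :+ m :* x′) :+ (y :+ m :* x)) :+ con true :* ((y′ :+ m′ :* x′) :+ (y :+ m′ :* x)))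
          refl x y x′ y′ m m′))

      -- Two such slopes differ by some δ with δ̄ x′ = δ x; if δ is nonzero, taking norms
      -- contradicts the hypothesis.
      second-unique : ∀ {p′} → norm (proj₁ p′) ≢ norm x → AtMost 1 (Second p′)
      second-unique {x′ , y′} nx′≢nx = atMost-1 {P = Second (x′ , y′)} λ {m} {m′} e e′
          → case (m + m′) ≟ 0# of λ where
        (yes δ≡0) → +≡0⇒≡ δ≡0
        (no δ≢0)  → contradiction (*-cancelˡ (norm≢0 δ≢0) (begin
          norm (m + m′) * norm x′          ≡⟨ cong (_* norm x′) (norm-bar (m + m′)) ⟨
          norm (bar (m + m′)) * norm x′    ≡⟨ norm-* (bar (m + m′)) x′ ⟨
          norm (bar (m + m′) * x′)         ≡⟨ cong norm (begin
            bar (m + m′) * x′                  ≡⟨ cong (_* x′) (bar-+ m m′) ⟩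
            (bar m + bar m′) * x′              ≡⟨ combine₂ 1# 1# e e′
                (solve 8 (λ x y x′ y′ m m′ m̄ m̄′ → (m̄ :+ m̄′) :* x′ :+ (m :+ m′) :* x
               := con true :* (y′ :+ (m̄ :* x′ :+ (y :+ m :* x)))
                   :+ con true :* (y′ :+ (m̄′ :* x′ :+ (y :+ m′ :* x))))
               refl x y x′ y′ m m′ (bar m) (bar m′)) ⟩
            (m + m′) * x                       ∎) ⟩
          norm ((m + m′) * x)              ≡⟨ norm-* (m + m′) x ⟩
          norm (m + m′) * norm x           ∎)) nx′≢nx

      -- The condition is a polynomial equation of degree q in m, with leading coefficient x′.
      second-few : ∀ {p′} → norm (proj₁ p′) ≡ norm x → AtMost q (Second p′)
      second-few {x′ , y′} nx′≡nx = atMost-⊆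
        (λ {m} e → combine₁ 1# e (solve 6 (λ x y x′ y′ m m̄ → (x′ :* m̄ :+ (x :* m :+ (y′ :+ y))) :+ con false
           := con true :* (y′ :+ (m̄ :* x′ :+ (y :+ m :* x)))) refl x y x′ y′ m (bar m)))
        (roots (poly-+< (poly-scale x′ (poly-x^ q)) (ℕ.*-monoʳ-≤ 2 (ℕ.m^n>0 2 h))
          (poly-+< (poly-scale x poly-x) (s≤s z≤n) (poly-k (y′ + y))))
          (x*y≢0 (norm≢0⇒≢0 (subst (_≢ 0#) (sym nx′≡nx) (U⇒≢0 ux))) 1≢0))

      Rival : A × A → Set
      Rival p′ = p′ ≡ (x₀ , y₀) ⊎ Transversal.Meets x y x≢0 p′

      rival? : Decidable Rival
      rival? p′@(x′ , y′) = (p′ ≟ₚ (x₀ , y₀)) ⊎-dec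
        ((form (x′ + x₀) (y′ + y₀) ≟ c) ×-dec (norm x′ ≟ norm x) ×-dec
            (((y′ + y) * bar x′) ≟ (bar (y′ + y) * x)))

      rivals-few : AtMost 7 Rival
      rivals-few = atMost-⊎ (atMost-1 {P = _≡ (x₀ , y₀)} λ { refl refl → refl }) (few x≢0) id

      -- Multiply y′ + y = m̄ x′ + m x by x̄′: as the norms agree, the right-hand side becomes (m
      -- x̄′ + m̄ x̄) x, whose first factor is the conjugate of y′ + y.
      rival : ∀ {p′ m} → Hyperoval p′ → norm (proj₁ p′) ≡ norm x → Second p′ m → Rival p′
      rival (inj₁ e) _ _ = inj₁ e
      rival {x′ , y′} {m} (inj₂ on′) nx′≡nx e = inj₂ (on′ , nx′≡nx , (begin
        (y′ + y) * bar x′                               ≡⟨ cong (_* bar x′) d≡ ⟩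
        (bar m * x′ + m * x) * bar x′                   ≡⟨ combine₁ (bar m) nx′≡nx
            (solve 6 (λ x x̄ x′ x̄′ m m̄ →
            (m̄ :* x′ :+ m :* x) :* x̄′ :+ (m :* x̄′ :+ m̄ :* x̄) :* x := m̄ :* (x′ :* x̄′ :+ x :* x̄))
            refl x (bar x) x′ (bar x′) m (bar m)) ⟩
        (m * bar x′ + bar m * bar x) * x                ≡⟨ cong (λ t → (t * bar x′ + bar m * bar x) * x)
            (bar-bar m) ⟨
        (bar (bar m) * bar x′ + bar m * bar x) * x      ≡⟨ cong (_* x)
            (trans (bar-+ (bar m * x′) (m * x)) (cong₂ _+_ (bar-* (bar m) x′) (bar-* m x))) ⟨
        bar (bar m * x′ + m * x) * x                    ≡⟨ cong (λ t → bar t * x) d≡ ⟨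
        bar (y′ + y) * x                                ∎))
        where
        d≡ : y′ + y ≡ bar m * x′ + m * x
        d≡ = combine₁ 1# e (solve 6 (λ x y x′ y′ m m̄ → (y′ :+ y) :+ (m̄ :* x′ :+ m :* x)
           := con true :* (y′ :+ (m̄ :* x′ :+ (y :+ m :* x)))) refl x y x′ y′ m (bar m))

      FirstSlope SecondSlope₁ SecondSlope₂ : A → Set u
      FirstSlope m   = ∃[ p′ ] (Inside p′ × First p′ m)
      SecondSlope₁ m = ∃[ p′ ] (Inside p′ × norm (proj₁ p′) ≢ norm x × Second p′ m)
      SecondSlope₂ m = ∃[ p′ ] (Inside p′ × norm (proj₁ p′) ≡ norm x × Second p′ m)

      slope : ∀ m → FirstSlope m ⊎ (SecondSlope₁ m ⊎ SecondSlope₂ m)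
      slope m with p′@(x′ , y′) , p′≢p , on′ , col ← chord p m on = case U? (norm x′) of λ where
          (yes ux′) → inj₁ (p′ , (on′ , ux′) , p′≢p , col)
          (no ¬ux′) → let p″ , p″≢p′ , on″ , l = hit m on′ ¬ux′ in case U? (norm (proj₁ p″)) of λ where
            -- For points with norm outside `U` the Moulton line is the affine line through p and
            -- p′, which has no third point of the hyperoval.
            (no ¬ux″) → contradiction
              (chord-unique on (λ { refl → ¬ux″ ux }) on″ (trans (outside ¬ux″ l) col) p′≢p on′ col) p″≢p′
            (yes ux″) → inj₂ (case norm (proj₁ p″) ≟ norm x of λ where
              (yes e) → inj₂ (p″ , (on″ , ux″) , e , inside ux″ l col)
              (no ne) → inj₁ (p″ , (on″ , ux″) , ne , inside ux″ l col))
        where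
        outside : ∀ {p′ x″ y″} → ¬ U (norm x″) → On m (proj₂ p′ + m * proj₁ p′) (x″ , y″)
            → Collinear m p′ (x″ , y″)
        outside {x′ , y′} {x″} {y″} ¬ux″ l = combine₁ 1# (trans l (cong (_+ (y′ + m * x′)) (⊙-outside m ¬ux″)))
          (solve 5 (λ m x′ y′ x″ y″ → (y″ :+ m :* x″) :+ (y′ :+ m :* x′)
              := con true :* (y″ :+ (m :* x″ :+ (y′ :+ m :* x′))))
             refl m x′ y′ x″ y″)
        inside : ∀ {p′ x″ y″} → U (norm x″) → On m (proj₂ p′ + m * proj₁ p′) (x″ , y″) → Collinear m p p′ →
                 Second (x″ , y″) m
        inside ux″ l col = trans l (cong₂ _+_ (⊙-inside m ux″) col)

      -- There are at most 2 n (q + 1) points inside: each is Q for at most one slope, and R for at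
      -- most one if its norm differs from that of x. The 7 rivals account for q slopes each.
      q*q≤ : ∀ {n} → AtMost n U →
             q ℕ.* q ℕ.≤ n ℕ.* (suc q ℕ.* 2) ℕ.+ (n ℕ.* (suc q ℕ.* 2) ℕ.* 1 ℕ.+ 7 ℕ.* q)
      q*q≤ {n} fewU = ℕ.≤-trans (ℕ.≤-reflexive (sym size≡q*q)) (Finite.size≤ finite slope (atMost-⊎
        (atMost-≤ (ℕ.≤-reflexive (ℕ.*-identityʳ (n ℕ.* (suc q ℕ.* 2))))
          (Finite.atMost-fibres plane inside? (inside-few fewU) (λ {p′} _ → first-unique p′) id))
        (atMost-⊎ (Finite.atMost-fibres plane inside? (inside-few fewU) (λ {p′} _ → second₁ p′) id)
          (Finite.atMost-fibres plane rival? rivals-few (λ {p′} _ → second₂ p′)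
            (λ (p′ , (on′ , _) , e , s) → p′ , rival on′ e s , e , s))
          id) id))
        where
        plane = finite-× finite finite
        inside? : Decidable Inside
        inside? p′ = hyperoval? p′ ×-dec U? (norm (proj₁ p′))
        second₁ : ∀ p′ → AtMost 1 (λ m → norm (proj₁ p′) ≢ norm x × Second p′ m)
        second₁ p′ with norm (proj₁ p′) ≟ norm x
        ... | yes e = atMost-≤ z≤n (atMost-0 λ (ne , _) → ne e)
        ... | no ne = atMost-⊆ proj₂ (second-unique ne)
        second₂ : ∀ p′ → AtMost q (λ m → norm (proj₁ p′) ≡ norm x × Second p′ m)
        second₂ p′ with norm (proj₁ p′) ≟ norm x
        ... | yes e = atMost-⊆ proj₂ (second-few e)
        ... | no ne = atMost-≤ z≤n (atMost-0 λ (e , _) → ne e)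

    -- As 4 divides q, the strict bound sharpens to n + 2 ≤ q / 4, that is, 4 n ≤ q - 8.
    arc⇒⊥ : ∀ {n ν h′} → h ≡ suc h′ → U ν → AtMost n U → 4 ℕ.* (n ℕ.+ 1) ℕ.< q → ⊥
    arc⇒⊥ {n} {h′ = h′} h≡ uν fewU 4[n+1]<q = ¬¬good-point (U⇒≢0 uν) (U⇒fixed uν) λ { {x} {y} on refl good →
      ℕ.<⇒≱ few (q*q≤ on uν good fewU) }
      where
      k = 2 ℕ.^ h′
      q≡4k : q ≡ 4 ℕ.* k
      q≡4k = trans (cong (λ h → 2 ℕ.^ suc h) h≡) (sym (ℕ.*-assoc 2 2 k))
      2+n≤k : 2 ℕ.+ n ℕ.≤ k
      2+n≤k = subst (ℕ._< k) (ℕ.+-comm n 1) (ℕ.*-cancelˡ-< 4 (n ℕ.+ 1) k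
          (subst (4 ℕ.* (n ℕ.+ 1) ℕ.<_) q≡4k 4[n+1]<q))
      few : n ℕ.* (suc q ℕ.* 2) ℕ.+ (n ℕ.* (suc q ℕ.* 2) ℕ.* 1 ℕ.+ 7 ℕ.* q) ℕ.< q ℕ.* q
      few with j , e ← ℕ.m≤n⇒∃[o]m+o≡n 2+n≤k =
        subst (λ q → n ℕ.* (suc q ℕ.* 2) ℕ.+ (n ℕ.* (suc q ℕ.* 2) ℕ.* 1 ℕ.+ 7 ℕ.* q) ℕ.< q ℕ.* q)
          (trans (cong (4 ℕ.*_) e) (sym q≡4k))
          (ℕ.m+n≤o⇒m≤o _ (ℕ.≤-reflexive (Arithmetic.[4[2+n+j]]² n j)))

-- Reduction of a projective conic to normal form.

module Conics (𝔽 : Char2Field) where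

  open Char2Field 𝔽 using () renaming (Carrier to A)
  open Char2 𝔽
  open Ovals 𝔽 using (Oval)
  open ≡-Reasoning

  quadratic : (xx yy zz xy xz yz : A) → A → A → A → A
  quadratic xx yy zz xy xz yz x y z =
    ((((xx * (x * x) + yy * (y * y)) + zz * (z * z)) + xy * (x * y)) + xz * (x * z)) + yz * (y * z)

  record AffineConic : Set where
    field
      xx yy zz xy xz yz n₁ n₂ n₃ : A

    Q : A → A → A → A
    Q = quadratic xx yy zz xy xz yz

    field
      nondegenerate : ∀ {x y z} → ¬ (x ≡ 0# × y ≡ 0# × z ≡ 0#) → Q x y z ≡ 0# →
        ¬ (∀ x′ y′ z′ → Q (x + x′) (y + y′) (z + z′) + - Q x y z + - Q x′ y′ z′ ≡ 0#)
      affine : ∀ {x y z} → ¬ (x ≡ 0# × y ≡ 0# × z ≡ 0#) → Q x y z ≡ 0# → z ≢ 0#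
      n₃≢0   : n₃ ≢ 0#
      tangent : ∀ {l₁ l₂ l₃ x y z} → ¬ (l₁ ≡ 0# × l₂ ≡ 0# × l₃ ≡ 0#) → ¬ (x ≡ 0# × y ≡ 0# × z ≡ 0#) →
        Q x y z ≡ 0# → l₁ * x + l₂ * y + l₃ * z ≡ 0# →
        (∀ {x′ y′ z′} → ¬ (x′ ≡ 0# × y′ ≡ 0# × z′ ≡ 0#) → Q x′ y′ z′ ≡ 0# → l₁ * x′ + l₂ * y′ + l₃ * z′ ≡ 0# →
          ∃[ t ] x′ ≡ t * x × y′ ≡ t * y × z′ ≡ t * z) →
        l₁ * n₁ + l₂ * n₂ + l₃ * n₃ ≡ 0#

  module _ (𝒞 : AffineConic) where
    open AffineConic 𝒞

    xx≢0 : xx ≢ 0#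
    xx≢0 e = affine {1#} {0#} {0#} (1≢0 ∘ proj₁) (combine₁ 1# e (solve 6 (λ xx yy zz xy xz yz →
      let x = con true ; y = con false ; z = con false in
      ((((xx :* (x :* x) :+ yy :* (y :* y)) :+ zz :* (z :* z)) :+ xy :* (x :* y)) :+ xz :* (x :* z))
          :+ yz :* (y :* z) :+ con false
      := con true :* (xx :+ con false)) refl xx yy zz xy xz yz)) refl

    yy≢0 : yy ≢ 0#
    yy≢0 e = affine {0#} {1#} {0#} (1≢0 ∘ proj₁ ∘ proj₂) (combine₁ 1# e (solve 6 (λ xx yy zz xy xz yz →
      let x = con false ; y = con true ; z = con false in
      ((((xx :* (x :* x) :+ yy :* (y :* y)) :+ zz :* (z :* z)) :+ xy :* (x :* y)) :+ xz :* (x :* z))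
          :+ yz :* (y :* z) :+ con false
      := con true :* (yy :+ con false)) refl xx yy zz xy xz yz)) refl

    -- Otherwise `Q` would be the square of a linear form on the line at infinity and vanish
    -- somewhere on it.
    xy≢0 : xy ≢ 0#
    xy≢0 e = affine {sqrt yy} {sqrt xx} {0#}
      (λ (_ , s≡0 , _) → xx≢0 (trans (sym (sqrt*sqrt xx)) (trans (cong (_* sqrt xx) s≡0) (zeroˡ _))))
      (combine₃ xx yy (sqrt yy * sqrt xx) (sqrt*sqrt yy) (sqrt*sqrt xx) e (solve 8 (λ xx yy zz xy xz yz x y →
        let z = con false in
        ((((xx :* (x :* x) :+ yy :* (y :* y)) :+ zz :* (z :* z)) :+ xy :* (x :* y)) :+ xz :* (x :* z))
            :+ yz :* (y :* z) :+ con false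
        := xx :* (x :* x :+ yy) :+ yy :* (y :* y :+ xx) :+ x :* y :* (xy :+ con false))
        refl xx yy zz xy xz yz (sqrt yy) (sqrt xx))) refl

    -- (yz , xz , xy) spans the radical of the polar form.
    radical-nonsingular : Q yz xz xy ≢ 0#
    radical-nonsingular e = nondegenerate (xy≢0 ∘ proj₂ ∘ proj₂) e λ x′ y′ z′ →
      solve 9 (λ xx yy zz xy xz yz x′ y′ z′ →
        let Q = λ x y z → ((((xx :* (x :* x) :+ yy :* (y :* y)) :+ zz :* (z :* z)) :+ xy :* (x :* y)) :+ xz :* (x :* z)) :+ yz :* (y :* z)
        in Q (yz :+ x′) (xz :+ y′) (xy :+ z′) :+ (:- Q yz xz xy) :+ (:- Q x′ y′ z′) := con false)
        refl xx yy zz xy xz yz x′ y′ z′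

    private
      i = inv xy

    xy*i≡1 : xy * i ≡ 1#
    xy*i≡1 = x*inv xy≢0

    i≢0 : i ≢ 0#
    i≢0 = x*y≡1⇒x≢0 (trans (*-comm i xy) xy*i≡1)

    -- (x₀, y₀, 1) is the radical vector divided by `xy`. Being orthogonal to everything, it splits
    -- off: Q (x, y, 1) = Q (s, t, 0) + Q (x₀, y₀, 1), where x = x₀ + s and y = y₀ + t. Division by
    -- `xy` normalises the mixed term and accounts for the third factor `i` in `c`.
    oval : Oval
    oval = record
      { x₀ = yz * i ; y₀ = xz * i ; a = xx * i ; b = yy * i ; c = i * (i * (i * Q yz xz xy))
      ; anisotropic = λ {s} {t} e → aniso s t (combine₂ (xx * (s * s) + yy * (t * t)) xy xy*i≡1 e
          (solve 9 (λ xx yy zz xy xz yz i s t → let z = con false in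
             ((((xx :* (s :* s) :+ yy :* (t :* t)) :+ zz :* (z :* z)) :+ xy :* (s :* t))
                 :+ xz :* (s :* z)) :+ yz :* (t :* z) :+ con false
             := (xx :* (s :* s) :+ yy :* (t :* t)) :* (xy :* i :+ con true) :+
                xy :* (xx :* i :* (s :* s) :+ s :* t :+ yy :* i :* (t :* t) :+ con false))
                    refl xx yy zz xy xz yz i s t))
      ; c≢0 = x*y≢0 i≢0 (x*y≢0 i≢0 (x*y≢0 i≢0 radical-nonsingular))
      }
      where
      aniso : ∀ s t → Q s t 0# ≡ 0# → s ≡ 0# × t ≡ 0#
      aniso s t e with s ≟ 0# | t ≟ 0#
      ... | yes s≡0 | yes t≡0 = s≡0 , t≡0
      ... | no s≢0  | _       = contradiction refl (affine (s≢0 ∘ proj₁) e)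
      ... | yes _   | no t≢0  = contradiction refl (affine (t≢0 ∘ proj₁ ∘ proj₂) e)

    open Oval oval hiding (c≢0)

    conic⇒Q≡0 : ∀ {x y} → Conic (x , y) → Q x y 1# ≡ 0#
    conic⇒Q≡0 {x} {y} on = x*y≡0⇒y≡0 i≢0 (combine₂ (x * y + i * zz * (1# + i * xy) + yz * xz * (i * i))
        1# xy*i≡1 on
      (solve 9 (λ xx yy zz xy xz yz i x y →
        let Q = λ x y z → ((((xx :* (x :* x) :+ yy :* (y :* y)) :+ zz :* (z :* z)) :+ xy :* (x :* y)) :+ xz :* (x :* z)) :+ yz :* (y :* z)
            s = x :+ yz :* i ; t = y :+ xz :* i
        in i :* Q x y (con true) :+ con false
           := (x :* y :+ i :* zz :* (con true :+ i :* xy) :+ yz :* xz :* (i :* i)) :* (xy :* i :+ con true) :+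
              con true :* ((xx :* i :* (s :* s) :+ s :* t :+ yy :* i :* (t :* t))
                  :+ i :* (i :* (i :* Q yz xz xy))))
        refl xx yy zz xy xz yz i x y))

    xy*x₀≡yz : xy * x₀ ≡ yz
    xy*x₀≡yz = combine₁ yz xy*i≡1 (solve 3 (λ d e i → d :* (e :* i) :+ e := e :* (d :* i :+ con true))
        refl xy yz i)

    xy*y₀≡xz : xy * y₀ ≡ xz
    xy*y₀≡xz = combine₁ xz xy*i≡1 (solve 3 (λ d e i → d :* (e :* i) :+ e := e :* (d :* i :+ con true))
        refl xy xz i)

    private
      x₁ y₁ : A
      x₁ = sqrt (inv xx * (yy * (y₀ * y₀) + zz + yz * y₀))
      y₁ = sqrt (inv yy * (xx * (x₀ * x₀) + zz + xz * x₀))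

      square : ∀ {e k} → e ≢ 0# → e * (sqrt (inv e * k) * sqrt (inv e * k)) ≡ k
      square {e} {k} e≢0 = begin
        e * (sqrt (inv e * k) * sqrt (inv e * k))   ≡⟨ cong (e *_) (sqrt*sqrt (inv e * k)) ⟩
        e * (inv e * k)                             ≡⟨ *-assoc e (inv e) k ⟨
        e * inv e * k                               ≡⟨ cong (_* k) (x*inv e≢0) ⟩
        1# * k                                      ≡⟨ *-identityˡ k ⟩
        k                                           ∎

      -- On the vertical through the radical point the terms in y z cancel, so `Q` is a multiple of
      -- a square and the line is tangent at (x₀, y₁, 1).
      Q-x₀ : ∀ {y z} → Q (x₀ * z) y z ≡ yy * ((y + y₁ * z) * (y + y₁ * z))
      Q-x₀ {y} {z} = combine₂ (y * z) (z * z) xy*x₀≡yz (square {k = xx * (x₀ * x₀) + zz + xz * x₀} yy≢0)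
        (solve 10 (λ xx yy zz xy xz yz x₀ y₁ y z → let x = x₀ :* z in
          ((((xx :* (x :* x) :+ yy :* (y :* y)) :+ zz :* (z :* z)) :+ xy :* (x :* y)) :+ xz :* (x :* z))
              :+ yz :* (y :* z) :+
          yy :* ((y :+ y₁ :* z) :* (y :+ y₁ :* z))
          := y :* z :* (xy :* x₀ :+ yz) :+ z :* z :* (yy :* (y₁ :* y₁) :+ (xx :* (x₀ :* x₀) :+ zz :+ xz :* x₀)))
          refl xx yy zz xy xz yz x₀ y₁ y z)

      Q-y₀ : ∀ {x z} → Q x (y₀ * z) z ≡ xx * ((x + x₁ * z) * (x + x₁ * z))
      Q-y₀ {x} {z} = combine₂ (x * z) (z * z) xy*y₀≡xz (square {k = yy * (y₀ * y₀) + zz + yz * y₀} xx≢0)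
        (solve 10 (λ xx yy zz xy xz yz y₀ x₁ x z → let y = y₀ :* z in
          ((((xx :* (x :* x) :+ yy :* (y :* y)) :+ zz :* (z :* z)) :+ xy :* (x :* y)) :+ xz :* (x :* z))
              :+ yz :* (y :* z) :+
          xx :* ((x :+ x₁ :* z) :* (x :+ x₁ :* z))
          := x :* z :* (xy :* y₀ :+ xz) :+ z :* z :* (xx :* (x₁ :* x₁) :+ (yy :* (y₀ :* y₀) :+ zz :+ yz :* y₀)))
          refl xx yy zz xy xz yz y₀ x₁ x z)

      double-root : ∀ {e s} → e ≢ 0# → e * (s * s) ≡ 0# → s ≡ 0#
      double-root {e} {s} e≢0 eq with s ≟ 0#
      ... | yes s≡0 = s≡0
      ... | no s≢0  = contradiction eq (x*y≢0 e≢0 (x*y≢0 s≢0 s≢0))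

    -- The nucleus is given only through tangents. It lies on the vertical tangent through the
    -- radical point, and on the horizontal one by `n₂≡y₀n₃`; hence it is the radical point.
    n₁≡x₀n₃ : n₁ ≡ x₀ * n₃
    n₁≡x₀n₃ = combine₁ 1# (tangent {1#} {0#} {x₀} {x₀} {y₁} {1#} (1≢0 ∘ proj₁) (1≢0 ∘ proj₂ ∘ proj₂)
        (trans (cong (λ x → Q x y₁ 1#) (sym (*-identityʳ x₀))) (trans Q-x₀
          (solve 2 (λ e y → e :* ((y :+ y :* con true) :* (y :+ y :* con true)) := con false) refl yy y₁)))
        (solve 2 (λ x y → con true :* x :+ con false :* y :+ x :* con true := con false) refl x₀ y₁)
        λ {x} {y} {z} _ on l → let x≡ = on-x₀ l in z , trans x≡ (*-comm x₀ z) ,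
          trans (+≡0⇒≡ (double-root yy≢0 (trans (sym Q-x₀) (trans (cong (λ x → Q x y z) (sym x≡)) on))))
              (*-comm y₁ z) ,
          sym (*-identityʳ z))
      (solve 4 (λ n₁ n₂ n₃ x₀ → n₁ :+ x₀ :* n₃ := con
          true :* (con true :* n₁ :+ con false :* n₂ :+ x₀ :* n₃ :+ con false)) refl n₁ n₂ n₃ x₀)
      where
      on-x₀ : ∀ {x y z} → 1# * x + 0# * y + x₀ * z ≡ 0# → x ≡ x₀ * z
      on-x₀ {x} {y} {z} l = combine₁ 1# l (solve 4 (λ x y z x₀ → x :+ x₀ :* z
        := con true :* (con true :* x :+ con false :* y :+ x₀ :* z :+ con false)) refl x y z x₀)

    n₂≡y₀n₃ : n₂ ≡ y₀ * n₃
    n₂≡y₀n₃ = combine₁ 1# (tangent {0#} {1#} {y₀} {x₁} {y₀} {1#} (1≢0 ∘ proj₁ ∘ proj₂) (1≢0 ∘ proj₂ ∘ proj₂)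
        (trans (cong (λ y → Q x₁ y 1#) (sym (*-identityʳ y₀))) (trans Q-y₀
          (solve 2 (λ e y → e :* ((y :+ y :* con true) :* (y :+ y :* con true)) := con false) refl xx x₁)))
        (solve 2 (λ x y → con false :* x :+ con true :* y :+ y :* con true := con false) refl x₁ y₀)
        λ {x} {y} {z} _ on l → let y≡ = on-y₀ l in z ,
          trans (+≡0⇒≡ (double-root xx≢0 (trans (sym Q-y₀) (trans (cong (λ y → Q x y z) (sym y≡)) on))))
              (*-comm x₁ z) ,
          trans y≡ (*-comm y₀ z) , sym (*-identityʳ z))
      (solve 4 (λ n₁ n₂ n₃ y₀ → n₂ :+ y₀ :* n₃ := con
          true :* (con false :* n₁ :+ con true :* n₂ :+ y₀ :* n₃ :+ con false)) refl n₁ n₂ n₃ y₀)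
      where
      on-y₀ : ∀ {x y z} → 0# * x + 1# * y + y₀ * z ≡ 0# → y ≡ y₀ * z
      on-y₀ {x} {y} {z} l = combine₁ 1# l (solve 4 (λ x y z y₀ → y :+ y₀ :* z
        := con true :* (con false :* x :+ con true :* y :+ y₀ :* z :+ con false)) refl x y z y₀)

    hyperoval⇒ : ∀ {x y} → Hyperoval (x , y) →
                 Q x y 1# ≡ 0# ⊎ (∃[ t ] x ≡ t * n₁ × y ≡ t * n₂ × 1# ≡ t * n₃)
    hyperoval⇒ (inj₂ on)   = inj₁ (conic⇒Q≡0 on)
    hyperoval⇒ (inj₁ refl) = inj₂ (inv n₃ , scaled n₁≡x₀n₃ , scaled n₂≡y₀n₃ , sym
        (trans (*-comm _ n₃) (x*inv n₃≢0)))
      where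
      scaled : ∀ {n k} → n ≡ k * n₃ → k ≡ inv n₃ * n
      scaled {n} {k} e = combine₂ k (inv n₃) (x*inv n₃≢0) e
        (solve 4 (λ n k n₃ i → k :+ i :* n := k :* (n₃ :* i :+ con true) :+ i :* (n :+ k :* n₃))
            refl n k n₃ (inv n₃))

-- A finite Heyting field transported to the type Fin N, where equality is propositional.
module Transport {c ℓ₁ ℓ₂ : Level} (K : HeytingField c ℓ₁ ℓ₂) (s : ℕ)
  (order : FieldTheory.HasOrder K ((2 ℕ.^ suc s) ℕ.^ 2)) where

  private
    module K = HeytingField K
    module KR = CommutativeRing (HeytingCommutativeRing.commutativeRing K.heytingCommutativeRing)
  open K using (_≈_)

  N : ℕ
  N = (2 ℕ.^ suc s) ℕ.^ 2

  to : K.Carrier → Fin N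
  to = Inverse.to order

  from : Fin N → K.Carrier
  from = Inverse.from order

  to-cong : ∀ {x y} → x ≈ y → to x ≡ to y
  to-cong = Inverse.to-cong order

  to-from : ∀ i → to (from i) ≡ i
  to-from = Inverse.strictlyInverseˡ order

  from-to : ∀ x → from (to x) ≈ x
  from-to = Inverse.strictlyInverseʳ order

  from-≡ : ∀ {i j} → i ≡ j → from i ≈ from j
  from-≡ refl = KR.refl

  from-injective : ∀ {i j} → from i ≈ from j → i ≡ j
  from-injective e = trans (sym (to-from _)) (trans (to-cong e) (to-from _))

  private
    F-rawRing : RawRing _ _
    F-rawRing = record
      { Carrier = Fin N ; _≈_ = _≡_
      ; _+_ = λ i j → to (from i K.+ from j) ; _*_ = λ i j → to (from i K.* from j) ; -_ = λ i → to (K.- from i)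
      ; 0# = to K.0# ; 1# = to K.1# }

    from-mono : IsRingMonomorphism F-rawRing KR.rawRing from
    from-mono = record
      { isRingHomomorphism = record
        { isSemiringHomomorphism = record
          { isNearSemiringHomomorphism = record
            { +-isMonoidHomomorphism = record
              { isMagmaHomomorphism = record
                { isRelHomomorphism = record { cong = from-≡ }
                ; homo = λ _ _ → from-to _ }
              ; ε-homo = from-to _ }
            ; *-homo = λ _ _ → from-to _ }
          ; 1#-homo = from-to _ }
        ; -‿homo = λ _ → from-to _ }
      ; injective = from-injective }

    isCommutativeRing : IsCommutativeRing _≡_ _ _ _ _ _
    isCommutativeRing = RingMonomorphism.isCommutativeRing from-mono KR.isCommutativeRing

    1≉0 : ¬ K.1# ≈ K.0#
    1≉0 e = K.#-irrefl e (HCR.1#0 K.heytingCommutativeRing)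

    1≢0 : to K.1# ≢ to K.0#
    1≢0 e = 1≉0 (KR.trans (KR.sym (from-to _)) (KR.trans (from-≡ e) (from-to _)))

    -- An element without an inverse is not apart from zero, hence zero by tightness.
    inverse : ∀ {i} → i ≢ to K.0# → ∃[ j ] to (from i K.* from j) ≡ to K.1#
    inverse {i} i≢0 with Fin.any? (λ j → to (from i K.* from j) Fin.≟ to K.1#)
    ... | yes found = found
    ... | no none   = contradiction (trans (sym (to-from i)) (to-cong (proj₁ (K.tight _ _) not-apart))) i≢0
      where
      not-apart : ¬ (from i K.# K.0#)
      not-apart i#0 with y , _ , iy≈1 ← K.#⇒invertible i#0 = none (to y , to-cong (KR.trans
        (KR.*-cong (KR.sym (HCR.x-0≈x K.heytingCommutativeRing (from i))) (from-to y)) iy≈1))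

    module F = Fields isCommutativeRing Fin._≟_ 1≢0 inverse
    open F using (_+_; _*_; -_; 0#; 1#; _^_)

    add-1 : Permutation′ N
    add-1 = permutation (1# +_) (- 1# +_)
      (λ i → trans (sym (F.+-assoc 1# (- 1#) i)) (trans (cong (_+ i) (F.-‿inverseʳ 1#)) (F.+-identityˡ i)))
      (λ i → trans (sym (F.+-assoc (- 1#) 1# i)) (trans (cong (_+ i) (F.-‿inverseˡ 1#)) (F.+-identityˡ i)))

    mul-by : ∀ {i} → i ≢ 0# → Permutation′ N
    mul-by {i} i≢0 = permutation (i *_) (i⁻¹ *_)
      (λ j → trans (sym (F.*-assoc i i⁻¹ j)) (trans (cong (_* j) e) (F.*-identityˡ j)))
      (λ j → trans (sym (F.*-assoc i⁻¹ i j)) (trans (cong (_* j) (trans (F.*-comm i⁻¹ i) e)) (F.*-identityˡ j)))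
      where
      i⁻¹ = proj₁ (inverse i≢0)
      e = proj₂ (inverse i≢0)

  𝔽 : Char2Field
  𝔽 = record
    { isCommutativeRing = isCommutativeRing
    ; _≟_     = Fin._≟_
    ; 1≢0     = 1≢0
    ; inverse = inverse
    ; 1+1≡0   = F.2^k·1≡0⇒1+1≡0 (suc s ℕ.* 2) (subst (λ n → n F.· 1# ≡ 0#) (ℕ.^-*-assoc 2 (suc s) 2)
                  (F.n·a≡0 id add-1 (λ _ → refl)))
    ; finite  = finite-Fin N
    ; h       = s
    ; size≡q*q = trans (size-Fin N) N≡q*q
    ; x^q*q≡x = λ x → trans (cong (x ^_) (sym N≡q*q)) (fermat x)
    }
    where
    N≡q*q : N ≡ 2 ℕ.^ suc s ℕ.* 2 ℕ.^ suc s
    N≡q*q = cong (2 ℕ.^ suc s ℕ.*_) (ℕ.*-identityʳ (2 ℕ.^ suc s))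
    fermat : ∀ x → x ^ N ≡ x
    fermat x with x Fin.≟ 0#
    ... | no x≢0 = F.a^n≡a id (mul-by x≢0) x≢0 (λ _ → refl) refl id
    ... | yes refl = subst (λ n → 0# ^ n ≡ 0#) (ℕ.suc-pred N) (F.zeroˡ _)
      where instance
        _ = ℕ.m^n≢0 2 (suc s)
        _ = ℕ.m^n≢0 (2 ℕ.^ suc s) 2

-- The hypotheses on the subfield and on Ω in the transported field.

module Transported {c ℓ₁ ℓ₂ : Level} (K : HeytingField c ℓ₁ ℓ₂) (s : ℕ)
  (order : FieldTheory.HasOrder K ((2 ℕ.^ suc s) ℕ.^ 2)) where

  open Transport K s order
  open Char2 𝔽
  private
    module K = HeytingField K
    module KR = CommutativeRing (HeytingCommutativeRing.commutativeRing K.heytingCommutativeRing)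
    A = Fin N
  open FieldTheory K using () renaming (_^_ to _^ᴷ_)
  open K using (_≈_)
  open Conics 𝔽 using (AffineConic; quadratic; oval; hyperoval⇒)

  to-injective : ∀ {x y} → to x ≡ to y → x ≈ y
  to-injective e = KR.trans (KR.sym (from-to _)) (KR.trans (from-≡ e) (from-to _))

  to-+ : ∀ x y → to (x K.+ y) ≡ to x + to y
  to-+ x y = to-cong (KR.+-cong (KR.sym (from-to x)) (KR.sym (from-to y)))

  to-* : ∀ x y → to (x K.* y) ≡ to x * to y
  to-* x y = to-cong (KR.*-cong (KR.sym (from-to x)) (KR.sym (from-to y)))

  to-neg : ∀ x → to (K.- x) ≡ - to x
  to-neg x = to-cong (KR.-‿cong (KR.sym (from-to x)))

  from-^ : ∀ i n → from (i ^ n) ≈ from i ^ᴷ n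
  from-^ i zero    = from-to _
  from-^ i (suc n) = KR.trans (from-to _) (KR.*-cong KR.refl (from-^ i n))

  ≡0⇒≈0 : ∀ {x i} → to x ≡ i → i ≡ 0# → x ≈ K.0#
  ≡0⇒≈0 e e′ = to-injective (trans e e′)

  -- Fermat's argument for an enumeration of `F`: closure under inverses makes multiplication by ν a
  -- permutation of the indices. With n = q it shows that `bar` fixes the elements of `U`.
  subfield-fixed : ∀ {f n} {F : Pred K.Carrier f} → FieldTheory.IsSubfield K F → Subsets.∣_∣≡_ KR.setoid F n →
                   ∀ {ν} → F ν → ¬ ν ≈ K.0# → to ν ^ n ≡ to ν
  subfield-fixed {n = n} {F} isSubfield size {ν} Fν ν≉0 =
    a^n≡a (to ∘ e) π ν̂≢0 (λ i → trans (to-cong (e-index _ _)) (to-* ν (e i))) {o = index K.0# 0-closed}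
      (to-cong (e-index K.0# 0-closed))
      (λ {i} ei≡0 → trans (sym (Inverse.strictlyInverseˡ size i)) (Inverse.to-cong size (to-injective ei≡0)))
    where
    open FieldTheory.IsSubfield isSubfield
    e : Fin n → K.Carrier
    e i = proj₁ (Inverse.from size i)
    e∈F : ∀ i → F (e i)
    e∈F i = proj₂ (Inverse.from size i)
    index : ∀ x → F x → Fin n
    index x Fx = Inverse.to size (x , Fx)
    e-index : ∀ x Fx → e (index x Fx) ≈ x
    e-index x Fx = Inverse.strictlyInverseʳ size (x , Fx)
    ν̂≢0 : to ν ≢ 0#
    ν̂≢0 = ν≉0 ∘ to-injective
    ν⁻¹ : K.Carrier
    ν⁻¹ = from (inv (to ν))
    νν⁻¹≈1 : ν K.* ν⁻¹ ≈ K.1#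
    νν⁻¹≈1 = to-injective (trans (to-* ν ν⁻¹) (trans (cong (to ν *_) (to-from _)) (x*inv ν̂≢0)))
    Fν⁻¹ : F ν⁻¹
    Fν⁻¹ = inv-closed Fν νν⁻¹≈1
    scale : ∀ {μ} → F μ → Fin n → Fin n
    scale {μ} Fμ i = index (μ K.* e i) (*-closed Fμ (e∈F i))
    scale-scale : ∀ {μ λ′} (Fμ : F μ) (Fλ : F λ′) → μ K.* λ′ ≈ K.1# → ∀ i → scale Fμ (scale Fλ i) ≡ i
    scale-scale {μ} {λ′} Fμ Fλ μλ≈1 i = trans (Inverse.to-cong size (KR.trans (KR.*-cong KR.refl (e-index _ _))
      (KR.trans (KR.sym (KR.*-assoc μ λ′ (e i))) (KR.trans (KR.*-cong μλ≈1 KR.refl) (KR.*-identityˡ (e i))))))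
      (Inverse.strictlyInverseˡ size i)
    π : Permutation′ n
    π = permutation (scale Fν) (scale Fν⁻¹) (scale-scale Fν Fν⁻¹ νν⁻¹≈1)
      (scale-scale Fν⁻¹ Fν (KR.trans (KR.*-comm ν⁻¹ ν) νν⁻¹≈1))

  module _ {o} {Ω : Pred (FieldTheory.AffinePoint K) o}
      (regular : ProjectivePlane.IsRegularAffineHyperoval K Ω) where

    open ProjectivePlane K
    open IsRegularAffineHyperoval regular
    open QuadraticForm form renaming (xx to xxᴷ; yy to yyᴷ; zz to zzᴷ; xy to xyᴷ; xz to xzᴷ; yz to yzᴷ)

    private
      Q̂ : A → A → A → A
      Q̂ = quadratic (to xxᴷ) (to yyᴷ) (to zzᴷ) (to xyᴷ) (to xzᴷ) (to yzᴷ)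

      Q̂-cong : ∀ {x y z x′ y′ z′} → x ≡ x′ → y ≡ y′ → z ≡ z′ → Q̂ x y z ≡ Q̂ x′ y′ z′
      Q̂-cong refl refl refl = refl

      to-eval : ∀ x y z → to (eval form (x , y , z)) ≡ Q̂ (to x) (to y) (to z)
      to-eval x y z = ⊕ (⊕ (⊕ (⊕ (⊕ (term xxᴷ x x) (term yyᴷ y y)) (term zzᴷ z z)) (term xyᴷ x y))
          (term xzᴷ x z)) (term yzᴷ y z)
        where
        ⊕ : ∀ {x y i j} → to x ≡ i → to y ≡ j → to (x K.+ y) ≡ i + j
        ⊕ e e′ = trans (to-+ _ _) (cong₂ _+_ e e′)
        term : ∀ k x y → to (k K.* (x K.* y)) ≡ to k * (to x * to y)
        term k x y = trans (to-* _ _) (cong (to k *_) (to-* x y))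

      eval-from : ∀ x y z → to (eval form (from x , from y , from z)) ≡ Q̂ x y z
      eval-from x y z = trans (to-eval _ _ _) (Q̂-cong (to-from x) (to-from y) (to-from z))

      from≈0 : ∀ {i} → from i ≈ K.0# → i ≡ 0#
      from≈0 e = trans (sym (to-from _)) (to-cong e)

      nonzero : ∀ {x y z} → ¬ (x ≡ 0# × y ≡ 0# × z ≡ 0#) → NonZero (from x , from y , from z)
      nonzero nz (e , e′ , e″) = nz (from≈0 e , from≈0 e′ , from≈0 e″)

      linear : ∀ {a b c x y z a′ b′ c′ x′ y′ z′} → to a ≡ a′ → to b ≡ b′ → to c ≡ c′ → to x ≡ x′ → to y
          ≡ y′ → to z ≡ z′ →
               to ((a K.* x K.+ b K.* y) K.+ c K.* z) ≡ a′ * x′ + b′ * y′ + c′ * z′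
      linear refl refl refl refl refl refl =
        trans (to-+ _ _) (cong₂ _+_ (trans (to-+ _ _) (cong₂ _+_ (to-* _ _) (to-* _ _))) (to-* _ _))

    n₁ᴷ n₂ᴷ n₃ᴷ : K.Carrier
    n₁ᴷ = proj₁ (proj₁ nucleus)
    n₂ᴷ = proj₁ (proj₂ (proj₁ nucleus))
    n₃ᴷ = proj₂ (proj₂ (proj₁ nucleus))

    affineConic : AffineConic
    affineConic = record
      { n₁ = to n₁ᴷ ; n₂ = to n₂ᴷ ; n₃ = to n₃ᴷ
      ; nondegenerate = λ {x} {y} {z} nz e radical → nondegenerate _ (nonzero nz)
          ( ≡0⇒≈0 (eval-from x y z) e
          , λ (x′ , y′ , z′) → ≡0⇒≈0 (polar-to x y z x′ y′ z′) (radical (to x′) (to y′) (to z′)) )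
      ; affine = λ {x} {y} {z} nz e z≡0 → allPointsAffine (_ , nonzero nz) (inj₁ (≡0⇒≈0 (eval-from x y z) e))
          (≡0⇒≈0 (to-from z) z≡0)
      ; n₃≢0 = λ e → allPointsAffine nucleus (inj₂ (K.1# , KR.sym (KR.*-identityˡ _) , KR.sym
          (KR.*-identityˡ _) , KR.sym (KR.*-identityˡ _)))
          (to-injective e)
      ; tangent = λ {l₁} {l₂} {l₃} {x} {y} {z} nzₗ nz on inc unique →
          trans (sym (linear (to-from l₁) (to-from l₂) (to-from l₃) refl refl refl)) (to-cong
            (isNucleus (_ , nonzero nzₗ)
              ( (_ , nonzero nz)
              , ≡0⇒≈0 (eval-from x y z) on
              , ≡0⇒≈0 (linear (to-from l₁) (to-from l₂) (to-from l₃) (to-from x) (to-from y) (to-from z)) inc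
              , λ ((x′ , y′ , z′) , nz′) on′ inc′ →
                  let t , e , e′ , e″ = unique (λ (e , e′ , e″) → nz′ (to-injective e , to-injective e′ , to-injective e″))
                        (trans (sym (to-eval x′ y′ z′)) (to-cong on′))
                        (trans (sym (linear (to-from l₁) (to-from l₂) (to-from l₃) refl refl refl))
                            (to-cong inc′))
                  in from t , multiple e , multiple e′ , multiple e″ )))
      }
      where
      multiple : ∀ {x t i} → to x ≡ t * i → x ≈ from t K.* from i
      multiple e = to-injective e
      polar-to : ∀ x y z x′ y′ z′ → to (polar form (from x , from y , from z) (x′ , y′ , z′)) ≡
                 Q̂ (x + to x′) (y + to y′) (z + to z′) + - Q̂ x y z + - Q̂ (to x′) (to y′) (to z′)
      polar-to x y z x′ y′ z′ = trans (to-+ _ _) (cong₂ _+_ (trans (to-+ _ _) (cong₂ _+_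
          (trans (to-eval _ _ _) (Q̂-cong (sum x x′) (sum y y′) (sum z z′)))
          (trans (to-neg _) (cong -_ (eval-from x y z)))))
        (trans (to-neg _) (cong -_ (to-eval x′ y′ z′))))
        where
        sum : ∀ i x → to (from i K.+ x) ≡ i + to x
        sum i x = trans (to-+ _ _) (cong (_+ to x) (to-from i))

    -- Through this inclusion a collinear triple found in the normal form becomes one of Ω.
    hyperoval⊆Ω : ∀ {x y} → Ovals.Oval.Hyperoval (oval affineConic) (x , y) → Ω (from x , from y)
    hyperoval⊆Ω {x} {y} h = Equivalence.from (points _) (case hyperoval⇒ affineConic h of λ where
      (inj₁ e) → inj₁ (≡0⇒≈0 (trans (to-eval _ _ _) (Q̂-cong (to-from x) (to-from y) refl)) e)
      (inj₂ (t , e , e′ , e″)) → inj₂ (from t , scaled e , scaled e′ , KR.trans (to-injective e″)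
          (KR.*-cong KR.refl (from-to _))))
      where
      scaled : ∀ {i t n} → i ≡ t * to n → from i ≈ from t K.* n
      scaled e = KR.trans (from-≡ e) (KR.trans (from-to _) (KR.*-cong KR.refl (from-to _)))

open import Algebra.Apartness.Bundles using (HeytingField)
open import Data.Nat.Base using (ℕ; _+_; _*_; _^_; _<_)
open import Data.Product.Base using (_×_; ∃-syntax)
open import Relation.Binary.Definitions using (_Respects_)
open import Relation.Binary.PropositionalEquality using (_≡_)
open import Relation.Nullary using (¬_)
open import Relation.Unary using (Pred; Decidable; Satisfiable; _⊆_)
open HeytingField using (Carrier; _≈_)
open FieldTheory using (setoid; HasOrder; IsSubfield; _⋆; AffinePoint)
open Subsets using (∣_∣≡_)
open ProjectivePlane using (IsRegularAffineHyperoval)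
open MoultonPlane using (IsInherited; ContainsThreeOf; asPoints)

-- The search for three points on a line.

module Search {c ℓ₁ ℓ₂ f u o : Level} (h′ : ℕ) (K : HeytingField c ℓ₁ ℓ₂)
    (order : HasOrder K ((2 ^ suc (suc h′)) ^ 2))
  (F : Pred (Carrier K) f) (isSubfield : IsSubfield K F) (sizeF : ∣_∣≡_ (setoid K) F (2 ^ suc (suc h′)))
  (U : Pred (Carrier K) u) (U-resp : U Respects (_≈_ K)) (U? : Decidable U) (U⊆F⋆ : U ⊆ _⋆ K F)
  (Ω : Pred (AffinePoint K) o) (regular : IsRegularAffineHyperoval K Ω) where

  private
    module K = HeytingField K
    module KR = CommutativeRing (HeytingCommutativeRing.commutativeRing K.heytingCommutativeRing)
    q = 2 ^ suc (suc h′)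
    module M = MoultonPlane K q U U?
  open Transport K (suc h′) order
  open Transported K (suc h′) order
  private
    open module C = Char2 𝔽 using (norm; bar; _≟_; 0#)
    A = Fin N

  𝒪 : Ovals.Oval 𝔽
  𝒪 = Conics.oval 𝔽 (affineConic regular)

  open Ovals.Oval 𝒪 using (Hyperoval)

  Û : A → Set u
  Û ν = U (from ν)

  Û⇒≢0 : ∀ {ν} → Û ν → ν ≢ 0#
  Û⇒≢0 uν refl = proj₂ (U⊆F⋆ uν) (from-to _)

  Û⇒fixed : ∀ {ν} → Û ν → bar ν ≡ ν
  Û⇒fixed {ν} uν = subst (λ μ → bar μ ≡ μ) (to-from ν)
    (subfield-fixed isSubfield sizeF (proj₁ (U⊆F⋆ uν)) (proj₂ (U⊆F⋆ uν)))

  open MoultonArcs 𝔽 𝒪 (λ ν → U? (from ν)) Û⇒≢0 Û⇒fixed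
  open Chords 𝔽 𝒪 using (hyperoval?; _≟ₚ_)

  from-⊙ : ∀ m x → from (m ⊙ x) K.≈ (from m M.⊙ from x)
  from-⊙ m x with U? (from (norm x)) | U? M.∥ from x ∥
  ... | yes _ | yes _  = KR.trans (from-to _) (KR.*-cong (from-^ m q) KR.refl)
  ... | no _  | no _   = from-to _
  ... | yes u | no ¬u  = contradiction (U-resp (from-^ x (suc q)) u) ¬u
  ... | no ¬u | yes u  = contradiction (U-resp (KR.sym (from-^ x (suc q))) u) ¬u

  from-on : ∀ {m n x y} → On m n (x , y) → from y K.≈ (from m M.⊙ from x) K.+ from n
  from-on {m} {n} {x} e = KR.trans (from-≡ e) (KR.trans (from-to _) (KR.+-cong (from-⊙ m x) KR.refl))

  point : A × A → M.Point
  point (x , y) = inj₁ (from x , from y)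

  point-injective : ∀ {p p′} → p ≢ p′ → ¬ point p M.≈ₚ point p′
  point-injective p≢p′ (Pointwise.inj₁ (e , e′)) = p≢p′ (cong₂ _,_ (from-injective e) (from-injective e′))

  Found : Set _
  Found = ∃[ L ] ContainsThreeOf K q U U? (asPoints K q U U? Ω) L

  LineTriple : A → A → A × A → A × A → A × A → Set
  LineTriple m n p p′ p″ =
    (p ≢ p′ × p ≢ p″ × p′ ≢ p″) × (Hyperoval p × Hyperoval p′ × Hyperoval p″)
        × (On m n p × On m n p′ × On m n p″)

  VerticalTriple : A → A → A → A → Set
  VerticalTriple x y y′ y″ =
    (y ≢ y′ × y ≢ y″ × y′ ≢ y″) × (Hyperoval (x , y) × Hyperoval (x , y′) × Hyperoval (x , y″))

  private
    any : ∀ {p} {P : A → Set p} → Decidable P → Dec (∃[ x ] P x)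
    any = Fin.any?
    anyₚ : ∀ {p} {P : A × A → Set p} → Decidable P → Dec (∃[ x ] P x)
    anyₚ = Finite.any? (finite-× (finite-Fin N) (finite-Fin N))

  on? : ∀ m n p → Dec (On m n p)
  on? m n (x , y) = y ≟ ((m ⊙ x) C.+ n)

  lineTriple? : Dec (∃[ m ] ∃[ n ] ∃[ p ] ∃[ p′ ] ∃[ p″ ] LineTriple m n p p′ p″)
  lineTriple? = any λ m → any λ n → anyₚ λ p → anyₚ λ p′ → anyₚ λ p″ →
    (¬? (p ≟ₚ p′) ×-dec ¬? (p ≟ₚ p″) ×-dec ¬? (p′ ≟ₚ p″)) ×-dec
    (hyperoval? p ×-dec hyperoval? p′ ×-dec hyperoval? p″) ×-dec (on? m n p ×-dec on? m n p′ ×-dec on? m n p″)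

  verticalTriple? : Dec (∃[ x ] ∃[ y ] ∃[ y′ ] ∃[ y″ ] VerticalTriple x y y′ y″)
  verticalTriple? = any λ x → any λ y → any λ y′ → any λ y″ →
    (¬? (y ≟ y′) ×-dec ¬? (y ≟ y″) ×-dec ¬? (y′ ≟ y″)) ×-dec
    (hyperoval? (x , y) ×-dec hyperoval? (x , y′) ×-dec hyperoval? (x , y″))

  -- All conditions on triples are decidable over the finite field, so the line can be searched for;
  -- the counting argument enters only to exclude that both searches fail.
  found : Satisfiable U → ∀ n → ∣_∣≡_ (setoid K) U n → 4 * (n + 1) < q → Found
  found (ν , uν) n sizeU 4[n+1]<q = case lineTriple? of λ where
      (yes (m , n , p , p′ , p″ , (≢₁ , ≢₂ , ≢₃) , (h , h′ , h″) , (l , l′ , l″))) →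
        M.line (from m) (from n) , point p , point p′ , point p″ ,
        (hyperoval⊆Ω regular h , hyperoval⊆Ω regular h′ , hyperoval⊆Ω regular h″) ,
        (point-injective ≢₁ , point-injective ≢₂ , point-injective ≢₃) , (from-on l , from-on l′ , from-on l″)
      (no noLine) → case verticalTriple? of λ where
        (yes (x , y , y′ , y″ , (≢₁ , ≢₂ , ≢₃) , (h , h′ , h″))) →
          M.vline (from x) , point (x , y) , point (x , y′) , point (x , y″) ,
          (hyperoval⊆Ω regular h , hyperoval⊆Ω regular h′ , hyperoval⊆Ω regular h″) ,
          (point-injective (≢₁ ∘ cong proj₂) , point-injective (≢₂ ∘ cong proj₂) , point-injective
              (≢₃ ∘ cong proj₂)) ,
          (KR.refl , KR.refl , KR.refl)
        (no noVertical) → ⊥-elim (arc⇒⊥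
          (λ ≢₁ ≢₂ ≢₃ h h′ h″ l l′ l″ → noLine (_ , _ , _ , _ , _ , (≢₁ , ≢₂ , ≢₃) , (h , h′ , h″) ,
              (l , l′ , l″)))
          (λ ≢₁ ≢₂ ≢₃ h h′ h″ → noVertical (_ , _ , _ , _ , (≢₁ , ≢₂ , ≢₃) , (h , h′ , h″)))
          refl (U-resp (KR.sym (from-to ν)) uν) few 4[n+1]<q)
    where
    few : AtMost n Û
    few = atMost-≤ (ℕ.≤-reflexive (size-Fin n)) (atMost-image (λ {i} uν → Inverse.to sizeU (from i , uν))
      (λ uν uμ e → from-injective (KR.trans (KR.sym (Inverse.strictlyInverseʳ sizeU (_ , uν)))
        (KR.trans (Inverse.from-cong sizeU e) (Inverse.strictlyInverseʳ sizeU (_ , uμ)))))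
      (λ _ → _) (Finite.atMost-size (finite-Fin n) {P = λ _ → ⊤}))

theorem1p2 : ∀ {c ℓ₁ ℓ₂ f u o} (h q : ℕ) → 1 < h → q ≡ 2 ^ h →
    (K : HeytingField c ℓ₁ ℓ₂) → HasOrder K (q ^ 2) →
    (F : Pred (Carrier K) f) → IsSubfield K F → ∣_∣≡_ (setoid K) F q →
    (U : Pred (Carrier K) u) → U Respects (_≈_ K) → (U? : Decidable U) →
    U ⊆ _⋆ K F → Satisfiable U →
    (n : ℕ) → ∣_∣≡_ (setoid K) U n → 4 * (n + 1) < q →
    (Ω : Pred (AffinePoint K) o) → IsRegularAffineHyperoval K Ω →
    ¬ IsInherited K q U U? Ω ×
    (∃[ L ] ContainsThreeOf K q U U? (asPoints K q U U? Ω) L)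
theorem1p2 (suc (suc h′)) _ (s≤s (s≤s z≤n)) refl K order F isSubfield sizeF U U-resp U? U⊆F⋆ nonempty n
    sizeU bound Ω regular =
  (λ arc → arc threeOnLine) , threeOnLine
  where
  threeOnLine : ∃[ L ] ContainsThreeOf K _ U U? (asPoints K _ U U? Ω) L
  threeOnLine = Search.found h′ K order F isSubfield sizeF U U-resp U? U⊆F⋆ Ω regular nonempty n sizeU bound
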